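{- Let $\mathcal{G}=(G_1,G_2,\ldots,G_n,\ldots)$ be any sequence of simple connected graphs, where $G_n$ has vertex set $[n]=\{1,\ldots,n\}$. Define $t=t(n)=\min\{r \mid P_{\mathcal{G}}(n,r)\ge 1/2\}$. Then $t$ is a threshold for $\mathcal{G}$, i.e. $t\in th(\mathcal{G})$.
   Context: A distribution of pebbles on a graph $G$ with vertex set $[n]$ is a function $D:[n]\to\mathbf{N}$ (nonnegative integers); its size is $\sum_i D(i)$. A pebbling step $[v,v']$ removes two pebbles from a vertex $v$ and places one pebble on an adjacent vertex $v'$. A distribution $D$ is $z$-solvable if, by a sequence of pebbling steps, one can reach a distribution with at least one pebble on $z$; $D$ is solvable if it is $z$-solvable for every vertex $z$. Pebbles are unlabeled and vertices labeled. $P_{\mathcal{G}}(n,t)$ denotes the probability that a distribution chosen uniformly at random from all distributions of size $t$ on $[n]$ is solvable on $G_n$. A function $t=t(n)$ is a threshold for $\mathcal{G}$, written $t\in th(\mathcal{G})$, if for every function $\omega=\omega(n)\to\infty$: (i) $P_{\mathcal{G}}(n,t\omega)\to 1$ and (ii) $P_{\mathcal{G}}(n,t/\omega)\to 0$ as $n\to\infty$ (non-integer values $t\omega$, $t/\omega$ are rounded to the nearest integer).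
   Formalization: In the definition of a threshold, the functions ω = ω(n) → ∞ range over positive rational-valued functions rather than real-valued ones. -}

module Defs where

open import Data.Nat as ℕ using (ℕ; zero; suc; _+_; _*_; _≤_; _<_)
open import Data.Bool using (Bool; true; false)
open import Data.Fin using (Fin)
open import Data.Vec using (Vec; lookup; _[_]%=_; sum)
open import Data.List using (List; length)
open import Data.List.Membership.Propositional using (_∈_)
open import Data.List.Relation.Unary.Unique.Propositional using (Unique)
open import Data.Product using (Σ; ∃; ∃-syntax; _×_; _,_)
open import Data.Integer using (ℤ; +_; ∣_∣)
open import Data.Rational as ℚ using (ℚ; _/_; _÷_; round; Positive)
open import Data.Rational.Properties using (pos⇒nonZero)
open import Relation.Binary.PropositionalEquality using (_≡_)
open import Relation.Binary.Construct.Closure.ReflexiveTransitive using (Star)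
open import Relation.Nullary using (¬_)
open import Function.Bundles using (_⇔_)

record SimpleGraph (n : ℕ) : Set where
  field
    adj     : Fin n → Fin n → Bool
    adj-sym : ∀ u v → adj u v ≡ adj v u
    irrefl  : ∀ v → adj v v ≡ false
open SimpleGraph public

Adj : ∀ {n} → SimpleGraph n → Fin n → Fin n → Set
Adj G u v = adj G u v ≡ true

Connected : ∀ {n} → SimpleGraph n → Set
Connected G = ∀ u v → Star (Adj G) u v

Distribution : ℕ → Set
Distribution n = Vec ℕ n

size : ∀ {n} → Distribution n → ℕ
size D = sum D

data PebblingStep {n} (G : SimpleGraph n) (D : Distribution n) : Distribution n → Set where
  step : ∀ u v → Adj G u v → 2 ≤ lookup D u →
         PebblingStep G D ((D [ u ]%= (λ x → x ℕ.∸ 2)) [ v ]%= suc)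

Reachable : ∀ {n} → SimpleGraph n → Distribution n → Distribution n → Set
Reachable G = Star (PebblingStep G)

SolvableAt : ∀ {n} → SimpleGraph n → Distribution n → Fin n → Set
SolvableAt G D z = ∃[ D' ] (Reachable G D D' × 1 ≤ lookup D' z)

Solvable : ∀ {n} → SimpleGraph n → Distribution n → Set
Solvable G D = ∀ z → SolvableAt G D z

Count : {A : Set} → (A → Set) → ℕ → Set
Count {A} P k = Σ (List A) λ L → Unique L × (∀ x → (x ∈ L) ⇔ P x) × length L ≡ k

NumDist : ℕ → ℕ → ℕ → Set
NumDist n r N = Count (λ (D : Distribution n) → size D ≡ r) N

NumSolvable : ∀ {n} → SimpleGraph n → ℕ → ℕ → Set
NumSolvable {n} G r k = Count (λ (D : Distribution n) → size D ≡ r × Solvable G D) k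

-- P_G(n,r) = k / N where k = #solvable, N = #all distributions of size r.

ProbAtLeastHalf : ∀ {n} → SimpleGraph n → ℕ → Set
ProbAtLeastHalf {n} G r =
  ∃[ k ] ∃[ N ] (NumSolvable G r k × NumDist n r N × N ≤ 2 * k)

IsMinHalf : ∀ {n} → SimpleGraph n → ℕ → Set
IsMinHalf G t = ProbAtLeastHalf G t × (∀ r → r < t → ¬ ProbAtLeastHalf G r)

-- P_G(n, s n) → 1 as n → ∞:
-- for every ε = 1/(m+1), eventually k/N ≥ 1 - 1/(m+1), i.e. m*N ≤ (m+1)*k
ProbTendsTo1 : (G : (n : ℕ) → SimpleGraph n) → (ℕ → ℕ) → Set
ProbTendsTo1 G s = ∀ m → ∃[ n₀ ] ∀ n → n₀ ≤ n → ∀ k N →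
  NumSolvable (G n) (s n) k → NumDist n (s n) N → m * N ≤ suc m * k

-- P_G(n, s n) → 0 as n → ∞:
-- for every ε = 1/(m+1), eventually k/N ≤ 1/(m+1), i.e. (m+1)*k ≤ N
ProbTendsTo0 : (G : (n : ℕ) → SimpleGraph n) → (ℕ → ℕ) → Set
ProbTendsTo0 G s = ∀ m → ∃[ n₀ ] ∀ n → n₀ ≤ n → ∀ k N →
  NumSolvable (G n) (s n) k → NumDist n (s n) N → suc m * k ≤ N

TendsToInfinity : (ℕ → ℚ) → Set
TendsToInfinity ω = ∀ (M : ℚ) → ∃[ n₀ ] ∀ n → n₀ ≤ n → M ℚ.≤ ω n

-- nearest integer (stdlib ℚ.round; values here are ≥ 0)
roundℕ : ℚ → ℕ
roundℕ q = ∣ round q ∣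

toℚ : ℕ → ℚ
toℚ m = (+ m) / 1

times : (ℕ → ℕ) → (ℕ → ℚ) → ℕ → ℕ
times t ω n = roundℕ (toℚ (t n) ℚ.* ω n)

divide : (t : ℕ → ℕ) → (ω : ℕ → ℚ) → (∀ n → Positive (ω n)) → ℕ → ℕ
divide t ω pos n =
  roundℕ ((toℚ (t n) ÷ ω n) {{pos⇒nonZero (ω n) {{pos n}}}})

IsThreshold : (G : (n : ℕ) → SimpleGraph n) → (ℕ → ℕ) → Set
IsThreshold G t = ∀ (ω : ℕ → ℚ) (pos : ∀ n → Positive (ω n)) →
  TendsToInfinity ω →
  ProbTendsTo1 G (times t ω) × ProbTendsTo0 G (divide t ω pos)

{-# OPTIONS --safe #-}

-- Solvability is monotone, so it suffices to amplify: if a monotone set of distributions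
-- has density at least 1/q in size t, it has density at least 1 − 1/q in every size above
-- K t, with K depending on q only.  A vector of n independent geometric variables with
-- parameter s is uniform on each size, and by Pólya's urn the density of a monotone set is
-- nondecreasing in the size, so densities can be compared with probabilities p(s) of the
-- set under the product law of mean size close to t.  Coordinatewise minima of
-- independent vectors give p(s ^ k) ≤ p(s) ^ k; reading a geometric variable as the number
-- of leading ones of a random bit sequence, disjunctions give
-- 1 − p(1 − (1 − s) ^ k) ≤ (1 − p(s)) ^ k.  Either bound brings p close to 1 for a
-- constant k.  When s is small (t below a constant multiple of n) the second costs
-- only a constant factor in the mean size; otherwise the first does.  All probabilities
-- are kept as natural numbers, scaled by the total mass of laws truncated at M.

module Submission where

open import Defs
open import Data.Bool using (true; false; if_then_else_) renaming (_≟_ to _≟ᵇ_)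
open import Data.Fin using (Fin; zero; suc)
open import Data.Fin.Properties using (any?; all?)
open import Data.List using (List; []; _∷_; _++_; map; filter; length)
open import Data.List.Membership.Propositional using (_∈_)
open import Data.List.Membership.Propositional.Properties
  using (∈-map⁺; ∈-map⁻; ∈-++⁺ˡ; ∈-++⁺ʳ; ∈-++⁻; ∈-filter⁺; ∈-filter⁻)
open import Data.List.Membership.Propositional.Properties.WithK using (unique∧set⇒bag)
open import Data.List.Properties using (map-∘; map-++)
open import Data.List.Relation.Binary.BagAndSetEquality using (∼bag⇒↭)
open import Data.List.Relation.Binary.Permutation.Propositional.Properties using (↭-length)
open import Data.List.Relation.Unary.All using ([])
open import Data.List.Relation.Unary.AllPairs using ([]; _∷_)
open import Data.List.Relation.Unary.Any using (here)
open import Data.List.Relation.Unary.Unique.Propositional using (Unique)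
import Data.List.Relation.Unary.Unique.Propositional.Properties as Unique
open import Data.Nat
open import Data.Nat.DivMod using (m/n*n≤m; m≡m%n+[m/n]*n; m%n<n)
open import Data.Nat.ListAction using () renaming (sum to sumˡ)
open import Data.Nat.ListAction.Properties using (sum-++)
open import Data.Nat.Properties
open import Data.Nat.Tactic.RingSolver using (solve-∀)
open import Data.Product using (_×_; _,_; proj₁; proj₂; ∃-syntax)
open import Data.Rational using (Positive) renaming (_≤_ to _≤ℚ_)
open import Data.Sum using (inj₁; inj₂)
open import Data.Vec using (Vec; []; _∷_; lookup; _[_]%=_) renaming (sum to total)
open import Function using (_∘_; const; case_of_; mk⇔; Equivalence)
open import Relation.Binary.Construct.Closure.ReflexiveTransitive using (ε; _◅_)
open import Relation.Binary.PropositionalEquality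
open import Relation.Nullary using (¬_; Dec; does; yes; no; contradiction; _×-dec_; map′)
open import Relation.Unary using (Decidable)

-- Products of truncated geometric laws

-- An unnormalised expectation. Monotonicity does double duty: it also yields `ext`, so that
-- integrands may be rewritten pointwise without function extensionality.
record Linear {A : Set} (I : (A → ℕ) → ℕ) : Set where
  field
    mono  : ∀ {φ ψ} → (∀ x → φ x ≤ ψ x) → I φ ≤ I ψ
    add   : ∀ φ ψ → I (λ x → φ x + ψ x) ≡ I φ + I ψ
    scale : ∀ k φ → I (λ x → k * φ x) ≡ k * I φ

  ext : ∀ {φ ψ} → (∀ x → φ x ≡ ψ x) → I φ ≡ I ψ
  ext eq = ≤-antisym (mono (≤-reflexive ∘ eq)) (mono (≤-reflexive ∘ sym ∘ eq))

  mass : ℕ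
  mass = I (const 1)

  I-const : ∀ k → I (const k) ≡ k * mass
  I-const k = trans (ext (λ _ → sym (*-identityʳ k))) (scale k (const 1))

  scaleʳ : ∀ φ k → I (λ x → φ x * k) ≡ I φ * k
  scaleʳ φ k = trans (ext (λ x → *-comm (φ x) k)) (trans (scale k φ) (*-comm k _))

tensor : ((ℕ → ℕ) → ℕ) → ∀ n → (Vec ℕ n → ℕ) → ℕ
tensor I zero    f = f []
tensor I (suc n) f = I (λ j → tensor I n (λ v → f (j ∷ v)))

module _ {I : (ℕ → ℕ) → ℕ} (L : Linear I) where
  open Linear

  tensor-linear : ∀ n → Linear (tensor I n)
  tensor-linear zero = record
    { mono = λ φ≤ψ → φ≤ψ [] ; add = λ _ _ → refl ; scale = λ _ _ → refl }
  tensor-linear (suc n) = record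
    { mono  = λ φ≤ψ → mono L (λ j → mono ih (λ v → φ≤ψ (j ∷ v)))
    ; add   = λ φ ψ → trans (ext L (λ j → add ih _ _)) (add L _ _)
    ; scale = λ k φ → trans (ext L (λ j → scale ih k _)) (scale L k _)
    }
    where ih = tensor-linear n

  tensor-mass : ∀ n → mass (tensor-linear n) ≡ mass L ^ n
  tensor-mass zero    = refl
  tensor-mass (suc n) = trans (ext L (λ _ → tensor-mass n))
    (trans (I-const L (mass L ^ n)) (*-comm (mass L ^ n) (mass L)))

  -- Linearity of expectation: the first coordinate and the sum of the others are integrated
  -- separately, each weighted by the mass of the other.
  tensor-total : ∀ n a c → c * I (λ j → j) ≤ a * mass L →
                 c * tensor I n total ≤ n * a * mass L ^ n
  tensor-total zero    a c _ = ≤-reflexive (*-zeroʳ c)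
  tensor-total (suc n) a c h = begin
    c * tensor I (suc n) total
      ≡⟨ cong (c *_) (ext L λ j → trans (add T (const j) total)
           (cong (_+ tensor I n total) (trans (I-const T j) (cong (j *_) (tensor-mass n))))) ⟩
    c * I (λ j → j * μ ^ n + tensor I n total)
      ≡⟨ cong (c *_) (trans (add L _ _) (cong₂ _+_ (scaleʳ L _ (μ ^ n)) (I-const L _))) ⟩
    c * (I (λ j → j) * μ ^ n + tensor I n total * μ)
      ≡⟨ r₁ c (I (λ j → j)) (μ ^ n) (tensor I n total) μ ⟩
    c * I (λ j → j) * μ ^ n + c * tensor I n total * μ
      ≤⟨ +-mono-≤ (*-monoˡ-≤ (μ ^ n) h) (*-monoˡ-≤ μ (tensor-total n a c h)) ⟩
    a * μ * μ ^ n + n * a * μ ^ n * μ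
      ≡⟨ r₂ a μ (μ ^ n) n ⟩
    suc n * a * (μ * μ ^ n) ∎
    where
    open ≤-Reasoning
    T = tensor-linear n
    μ = mass L
    r₁ : ∀ c x p t m → c * (x * p + t * m) ≡ c * x * p + c * t * m
    r₁ = solve-∀
    r₂ : ∀ a m p n → a * m * p + n * a * p * m ≡ (1 + n) * a * (m * p)
    r₂ = solve-∀

-- If Z is a function of independent X and Y to which R relates it, then
-- h(Z) ≤ f(X) g(Y) integrates to E h ≤ E f · E g; such inequalities tensorise.
ProductBound : {A : Set} (R : A → A → A → Set) (I J K : (A → ℕ) → ℕ) → Set
ProductBound R I J K = ∀ f g h → (∀ {x y z} → R x y z → h z ≤ f x * g y) → K h ≤ I f * J g

Lift : (ℕ → ℕ → ℕ → Set) → ∀ {n} → Vec ℕ n → Vec ℕ n → Vec ℕ n → Set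
Lift R x y z = ∀ i → R (lookup x i) (lookup y i) (lookup z i)

-- Integrating out all coordinates but the first leaves three functions of one variable; the
-- inductive hypothesis is the pointwise inequality between them that `B` asks for.
tensor-bound : ∀ {R I J K} → ProductBound R I J K →
               ∀ n → ProductBound (Lift R) (tensor I n) (tensor J n) (tensor K n)
tensor-bound B zero    f g h H = H {[]} {[]} {[]} (λ ())
tensor-bound B (suc n) f g h H = B _ _ _ λ r → tensor-bound B n _ _ _ λ rs →
  H λ { zero → r ; (suc i) → rs i }

-- The law of min(X, M), where P(X ≥ j) = (a / (a + c))^j, scaled to mass (a + c)^M.
geo : ℕ → ℕ → ℕ → (ℕ → ℕ) → ℕ
geo a c zero    φ = φ 0
geo a c (suc M) φ = c * (a + c) ^ M * φ 0 + a * geo a c M (φ ∘ suc)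

geo-linear : ∀ a c M → Linear (geo a c M)
geo-linear a c zero = record
  { mono = λ φ≤ψ → φ≤ψ 0 ; add = λ _ _ → refl ; scale = λ _ _ → refl }
geo-linear a c (suc M) = record
  { mono  = λ φ≤ψ → +-mono-≤ (*-monoʳ-≤ (c * b^M) (φ≤ψ 0)) (*-monoʳ-≤ a (mono ih (φ≤ψ ∘ suc)))
  ; add   = λ φ ψ → trans (cong (λ t → c * b^M * (φ 0 + ψ 0) + a * t) (add ih _ _))
                      (r₁ (c * b^M) (φ 0) (ψ 0) a _ _)
  ; scale = λ k φ → trans (cong (λ t → c * b^M * (k * φ 0) + a * t) (scale ih k _))
                      (r₂ (c * b^M) k (φ 0) a _)
  }
  where
  open Linear
  b^M = (a + c) ^ M
  ih = geo-linear a c M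
  r₁ : ∀ w x y a s t → w * (x + y) + a * (s + t) ≡ w * x + a * s + (w * y + a * t)
  r₁ = solve-∀
  r₂ : ∀ w k x a t → w * (k * x) + a * (k * t) ≡ k * (w * x + a * t)
  r₂ = solve-∀

module Geo a c M = Linear (geo-linear a c M)

geo-mass : ∀ a c M → Geo.mass a c M ≡ (a + c) ^ M
geo-mass a c zero    = refl
geo-mass a c (suc M) rewrite geo-mass a c M = r c ((a + c) ^ M) a
  where
  r : ∀ c p a → c * p * 1 + a * p ≡ (a + c) * p
  r = solve-∀

geo-const : ∀ a c M k → geo a c M (const k) ≡ k * (a + c) ^ M
geo-const a c M k = trans (Geo.I-const a c M k) (cong (k *_) (geo-mass a c M))

-- The untruncated variable has mean a / c, and truncation can only lower it. With weight a the
-- variable is one more than a fresh copy, otherwise it is 0.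
geo-mean : ∀ a c M → c * geo a c M (λ j → j) ≤ a * (a + c) ^ M
geo-mean a c zero    = ≤-trans (≤-reflexive (*-zeroʳ c)) z≤n
geo-mean a c (suc M) = begin
  c * (c * p * 0 + a * geo a c M suc)
    ≡⟨ cong (λ t → c * (c * p * 0 + a * t))
         (trans (Geo.add a c M (const 1) (λ j → j)) (cong (_+ m) (geo-mass a c M))) ⟩
  c * (c * p * 0 + a * (p + m))  ≡⟨ r₁ c p a m ⟩
  a * (c * p) + a * (c * m)      ≤⟨ +-monoʳ-≤ (a * (c * p)) (*-monoʳ-≤ a (geo-mean a c M)) ⟩
  a * (c * p) + a * (a * p)      ≡⟨ r₂ a c p ⟩
  a * ((a + c) * p) ∎
  where
  open ≤-Reasoning
  p = (a + c) ^ M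
  m = geo a c M (λ j → j)
  r₁ : ∀ c p a m → c * (c * p * 0 + a * (p + m)) ≡ a * (c * p) + a * (c * m)
  r₁ = solve-∀
  r₂ : ∀ a c p → a * (c * p) + a * (a * p) ≡ a * ((a + c) * p)
  r₂ = solve-∀

-- Minima and disjunctions of independent geometric variables

Below Above : ℕ → ℕ → ℕ → Set
Below x y z = z ≤ x × z ≤ y
Above x y z = x ≤ z × y ≤ z

+-mono₄ : ∀ {a b c d a′ b′ c′ d′} → a ≤ a′ → b ≤ b′ → c ≤ c′ → d ≤ d′ →
          a + b + c + d ≤ a′ + b′ + c′ + d′
+-mono₄ p q r s = +-mono-≤ (+-mono-≤ (+-mono-≤ p q) r) s

^-distribʳ-* : ∀ m n k → (m * n) ^ k ≡ m ^ k * n ^ k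
^-distribʳ-* m n zero    = refl
^-distribʳ-* m n (suc k) rewrite ^-distribʳ-* m n k = r m n (m ^ k) (n ^ k)
  where
  r : ∀ m n p q → m * n * (p * q) ≡ m * p * (n * q)
  r = solve-∀

-- min(X₁, X₂) is geometric: its parameter is the product of those of X₁ and X₂.
geo-min : ∀ a₁ c₁ a₂ c₂ M → ProductBound Below (geo a₁ c₁ M) (geo a₂ c₂ M)
            (geo (a₁ * a₂) (c₁ * (a₂ + c₂) + a₁ * c₂) M)
geo-min a₁ c₁ a₂ c₂ zero    f g h H = H (≤-refl , ≤-refl)
geo-min a₁ c₁ a₂ c₂ (suc M) f g h H = begin
  (c₁ * (a₂ + c₂) + a₁ * c₂) * b₀ ^ M * h 0 + a₁ * a₂ * h′
    ≡⟨ cong (λ p → (c₁ * (a₂ + c₂) + a₁ * c₂) * p * h 0 + a₁ * a₂ * h′) (b₀^M≡ M) ⟩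
  (c₁ * (a₂ + c₂) + a₁ * c₂) * (p₁ * p₂) * h 0 + a₁ * a₂ * h′
    ≡⟨ r₁ a₁ c₁ a₂ c₂ p₁ p₂ (h 0) h′ ⟩
  -- The summands are the cases X₁ = X₂ = 0, X₁ = 0 < X₂, X₂ = 0 < X₁ and both positive. In the
  -- first three the minimum is 0; `right` and `left` average over the variable that is positive.
  c₁ * p₁ * (c₂ * p₂) * h 0 + c₁ * p₁ * a₂ * (h 0 * p₂) + a₁ * (c₂ * p₂) * (h 0 * p₁) + a₁ * a₂ * h′
    ≤⟨ +-mono₄ (*-monoʳ-≤ (c₁ * p₁ * (c₂ * p₂)) (H {0} {0} (z≤n , z≤n)))
               (*-monoʳ-≤ (c₁ * p₁ * a₂) right) (*-monoʳ-≤ (a₁ * (c₂ * p₂)) left)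
               (*-monoʳ-≤ (a₁ * a₂) (geo-min a₁ c₁ a₂ c₂ M _ _ _ λ (p , q) → H (s≤s p , s≤s q))) ⟩
  c₁ * p₁ * (c₂ * p₂) * (f 0 * g 0) + c₁ * p₁ * a₂ * (f 0 * g′)
    + a₁ * (c₂ * p₂) * (f′ * g 0) + a₁ * a₂ * (f′ * g′)
    ≡⟨ r₂ (c₁ * p₁) (c₂ * p₂) a₁ a₂ (f 0) (g 0) f′ g′ ⟩
  (c₁ * p₁ * f 0 + a₁ * f′) * (c₂ * p₂ * g 0 + a₂ * g′) ∎
  where
  open ≤-Reasoning
  a₀ = a₁ * a₂
  b₀ = a₀ + (c₁ * (a₂ + c₂) + a₁ * c₂)
  p₁ = (a₁ + c₁) ^ M
  p₂ = (a₂ + c₂) ^ M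
  f′ = geo a₁ c₁ M (f ∘ suc)
  g′ = geo a₂ c₂ M (g ∘ suc)
  h′ = geo a₀ (c₁ * (a₂ + c₂) + a₁ * c₂) M (h ∘ suc)
  b₀^M≡ : ∀ M → b₀ ^ M ≡ (a₁ + c₁) ^ M * (a₂ + c₂) ^ M
  b₀^M≡ M = trans (cong (_^ M) (r a₁ c₁ a₂ c₂)) (^-distribʳ-* (a₁ + c₁) (a₂ + c₂) M)
    where
    r : ∀ a₁ c₁ a₂ c₂ → a₁ * a₂ + (c₁ * (a₂ + c₂) + a₁ * c₂) ≡ (a₁ + c₁) * (a₂ + c₂)
    r = solve-∀
  right : h 0 * p₂ ≤ f 0 * g′
  right = subst₂ _≤_ (geo-const a₂ c₂ M (h 0)) (Geo.scale a₂ c₂ M (f 0) (g ∘ suc))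
            (Geo.mono a₂ c₂ M (λ _ → H (z≤n , z≤n)))
  left : h 0 * p₁ ≤ f′ * g 0
  left = subst₂ _≤_ (geo-const a₁ c₁ M (h 0)) (Geo.scaleʳ a₁ c₁ M (f ∘ suc) (g 0))
            (Geo.mono a₁ c₁ M (λ _ → H (z≤n , z≤n)))
  r₁ : ∀ a₁ c₁ a₂ c₂ p₁ p₂ x y → (c₁ * (a₂ + c₂) + a₁ * c₂) * (p₁ * p₂) * x + a₁ * a₂ * y
     ≡ c₁ * p₁ * (c₂ * p₂) * x + c₁ * p₁ * a₂ * (x * p₂) + a₁ * (c₂ * p₂) * (x * p₁) + a₁ * a₂ * y
  r₁ = solve-∀
  r₂ : ∀ u v a₁ a₂ x y s t →
       u * v * (x * y) + u * a₂ * (x * t) + a₁ * v * (s * y) + a₁ * a₂ * (s * t)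
     ≡ (u * x + a₁ * s) * (v * y + a₂ * t)
  r₂ = solve-∀

-- Xᵢ counts the leading ones of a random bit sequence; here Z counts those of the
-- disjunction of the two sequences, which is geometric and at least max(X₁, X₂).
geo-max : ∀ a₁ c₁ a₂ c₂ M → ProductBound Above (geo a₁ c₁ M) (geo a₂ c₂ M)
            (geo (a₁ * (c₂ + a₂) + c₁ * a₂) (c₁ * c₂) M)
geo-max a₁ c₁ a₂ c₂ zero    f g h H = H (≤-refl , ≤-refl)
geo-max a₁ c₁ a₂ c₂ (suc M) f g h H = begin
  c₁ * c₂ * b₀ ^ M * h 0 + a₀ * h′
    ≡⟨ cong (λ p → c₁ * c₂ * p * h 0 + a₀ * h′) (b₀^M≡ M) ⟩
  c₁ * c₂ * (p₁ * p₂) * h 0 + a₀ * h′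
    ≡⟨ r₁ a₁ c₁ a₂ c₂ p₁ p₂ (h 0) h′ ⟩
  c₁ * p₁ * (c₂ * p₂) * h 0 + c₁ * a₂ * h′ + a₁ * c₂ * h′ + a₁ * a₂ * h′
    ≤⟨ +-mono₄ (*-monoʳ-≤ (c₁ * p₁ * (c₂ * p₂)) (H {0} {0} (z≤n , z≤n)))
         (*-monoʳ-≤ (c₁ * a₂) left) (*-monoʳ-≤ (a₁ * c₂) right)
         (*-monoʳ-≤ (a₁ * a₂) (ih _ _ λ (p , q) → H (s≤s p , s≤s q))) ⟩
  c₁ * p₁ * (c₂ * p₂) * (f 0 * g 0) + c₁ * a₂ * (f 0 * p₁ * g′)
    + a₁ * c₂ * (f′ * (g 0 * p₂)) + a₁ * a₂ * (f′ * g′)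
    ≡⟨ r₂ c₁ p₁ c₂ p₂ a₁ a₂ (f 0) (g 0) f′ g′ ⟩
  (c₁ * p₁ * f 0 + a₁ * f′) * (c₂ * p₂ * g 0 + a₂ * g′) ∎
  where
  open ≤-Reasoning
  a₀ = a₁ * (c₂ + a₂) + c₁ * a₂
  b₀ = a₀ + c₁ * c₂
  p₁ = (a₁ + c₁) ^ M
  p₂ = (a₂ + c₂) ^ M
  f′ = geo a₁ c₁ M (f ∘ suc)
  g′ = geo a₂ c₂ M (g ∘ suc)
  h′ = geo a₀ (c₁ * c₂) M (h ∘ suc)
  ih : ∀ f g → (∀ {x y z} → Above x y z → h (suc z) ≤ f x * g y) →
       h′ ≤ geo a₁ c₁ M f * geo a₂ c₂ M g
  ih f g H = geo-max a₁ c₁ a₂ c₂ M f g (h ∘ suc) H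
  b₀^M≡ : ∀ M → b₀ ^ M ≡ (a₁ + c₁) ^ M * (a₂ + c₂) ^ M
  b₀^M≡ M = trans (cong (_^ M) (r a₁ c₁ a₂ c₂)) (^-distribʳ-* (a₁ + c₁) (a₂ + c₂) M)
    where
    r : ∀ a₁ c₁ a₂ c₂ → a₁ * (c₂ + a₂) + c₁ * a₂ + c₁ * c₂ ≡ (a₁ + c₁) * (a₂ + c₂)
    r = solve-∀
  -- When exactly one first bit is 0, that variable is settled at 0 while its later bits still feed
  -- the disjunction. The induction hypothesis is therefore used with a constant function in its
  -- place.
  right : h′ ≤ f′ * (g 0 * p₂)
  right = ≤-trans (ih (f ∘ suc) (const (g 0)) λ (p , _) → H (s≤s p , z≤n))
            (≤-reflexive (cong (f′ *_) (geo-const a₂ c₂ M (g 0))))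
  left : h′ ≤ f 0 * p₁ * g′
  left = ≤-trans (ih (const (f 0)) (g ∘ suc) λ (_ , q) → H (z≤n , s≤s q))
            (≤-reflexive (cong (_* g′) (geo-const a₁ c₁ M (f 0))))
  r₁ : ∀ a₁ c₁ a₂ c₂ p₁ p₂ x y → c₁ * c₂ * (p₁ * p₂) * x + (a₁ * (c₂ + a₂) + c₁ * a₂) * y
     ≡ c₁ * p₁ * (c₂ * p₂) * x + c₁ * a₂ * y + a₁ * c₂ * y + a₁ * a₂ * y
  r₁ = solve-∀
  r₂ : ∀ c₁ p₁ c₂ p₂ a₁ a₂ x y s t →
       c₁ * p₁ * (c₂ * p₂) * (x * y) + c₁ * a₂ * (x * p₁ * t) + a₁ * c₂ * (s * (y * p₂)) + a₁ * a₂ * (s * t)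
     ≡ (c₁ * p₁ * x + a₁ * s) * (c₂ * p₂ * y + a₂ * t)
  r₂ = solve-∀

infix 4 _⊑_
_⊑_ : ∀ {n} → Vec ℕ n → Vec ℕ n → Set
x ⊑ y = ∀ i → lookup x i ≤ lookup y i

⊑-∷ : ∀ {n i j} {x y : Vec ℕ n} → i ≤ j → x ⊑ y → (i ∷ x) ⊑ (j ∷ y)
⊑-∷ p q zero    = p
⊑-∷ p q (suc i) = q i

⊑-refl : ∀ {n} {x : Vec ℕ n} → x ⊑ x
⊑-refl i = ≤-refl

Increasing Decreasing Bounded : ∀ {n} → (Vec ℕ n → ℕ) → Set
Increasing f = ∀ {x y} → x ⊑ y → f x ≤ f y
Decreasing f = ∀ {x y} → x ⊑ y → f y ≤ f x
Bounded f = ∀ x → f x ≤ 1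

-- This is (a + c)^k - a^k, in the form that `geo-min` and `geo-max` produce for one more copy. With
-- s = a / (a + c), `geo (a ^ k) (gap a c k)` has parameter s^k and `geo (gap c a k) (c ^ k)` has
-- parameter 1 - (1 - s)^k.
gap : ℕ → ℕ → ℕ → ℕ
gap a c zero    = 0
gap a c (suc k) = c * (a ^ k + gap a c k) + a * gap a c k

pow+gap : ∀ a c k → a ^ k + gap a c k ≡ (a + c) ^ k
pow+gap a c zero    = refl
pow+gap a c (suc k) = trans (r a (a ^ k) c (gap a c k)) (cong ((a + c) *_) (pow+gap a c k))
  where
  r : ∀ a p c g → a * p + (c * (p + g) + a * g) ≡ (a + c) * (p + g)
  r = solve-∀

-- The union bound 1 - s^k ≤ k (1 - s) for s = a / (a + c).
gap-upper : ∀ a c k → (a + c) * gap a c k ≤ k * c * (a + c) ^ k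
gap-upper a c zero    = ≤-reflexive (*-zeroʳ (a + c))
gap-upper a c (suc k) = begin
  b * (c * (a ^ k + g) + a * g)    ≡⟨ cong (λ p → b * (c * p + a * g)) (pow+gap a c k) ⟩
  b * (c * p + a * g)              ≡⟨ r₁ a c p g ⟩
  c * (b * p) + a * (b * g)        ≤⟨ +-monoʳ-≤ (c * (b * p)) (*-monoʳ-≤ a (gap-upper a c k)) ⟩
  c * (b * p) + a * (k * c * p)    ≤⟨ +-monoʳ-≤ (c * (b * p)) (*-monoˡ-≤ (k * c * p) (m≤m+n a c)) ⟩
  c * (b * p) + b * (k * c * p)    ≡⟨ r₂ a c p k ⟩
  suc k * c * (b * p) ∎
  where
  open ≤-Reasoning
  b = a + c
  g = gap a c k
  p = b ^ k
  r₁ : ∀ a c p g → (a + c) * (c * p + a * g) ≡ c * ((a + c) * p) + a * ((a + c) * g)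
  r₁ = solve-∀
  r₂ : ∀ a c p k → c * ((a + c) * p) + (a + c) * (k * c * p) ≡ (1 + k) * c * ((a + c) * p)
  r₂ = solve-∀

-- In terms of means, s^k / (1 - s^k) ≤ s / (1 - s): the minimum of at least one copy has no larger
-- mean than a single copy.
gap-lower : ∀ a c k .{{_ : NonZero k}} → c * a ^ k ≤ a * gap a c k
gap-lower a c (suc k) = begin
  c * (a * a ^ k)                          ≡⟨ r a c (a ^ k) ⟩
  a * (c * a ^ k)                          ≤⟨ *-monoʳ-≤ a (*-monoʳ-≤ c (m≤m+n (a ^ k) (gap a c k))) ⟩
  a * (c * (a ^ k + gap a c k))            ≤⟨ *-monoʳ-≤ a (m≤m+n _ _) ⟩
  a * (c * (a ^ k + gap a c k) + a * gap a c k) ∎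
  where
  open ≤-Reasoning
  r : ∀ a c p → c * (a * p) ≡ a * (c * p)
  r = solve-∀

E : ℕ → ℕ → ℕ → ∀ n → (Vec ℕ n → ℕ) → ℕ
E a c M = tensor (geo a c M)

E-linear : ∀ a c M n → Linear (E a c M n)
E-linear a c M = tensor-linear (geo-linear a c M)

module EL a c M n = Linear (E-linear a c M n)

E-mass : ∀ a c M n → E a c M n (const 1) ≡ ((a + c) ^ M) ^ n
E-mass a c M n = trans (tensor-mass (geo-linear a c M) n) (cong (_^ n) (geo-mass a c M))

E-total : ∀ a c M n → c * E a c M n total ≤ n * a * ((a + c) ^ M) ^ n
E-total a c M n = subst (λ m → c * E a c M n total ≤ n * a * m ^ n) (geo-mass a c M)
  (tensor-total (geo-linear a c M) n a c
    (subst (λ m → c * geo a c M (λ j → j) ≤ a * m) (sym (geo-mass a c M)) (geo-mean a c M)))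

1^n^m≡1 : ∀ M n → (1 ^ M) ^ n ≡ 1
1^n^m≡1 M n = trans (cong (_^ n) (^-zeroˡ M)) (^-zeroˡ n)

-- For values 0 and 1 a minimum is a product; this brings monotonicity into the form required by
-- `ProductBound`.
≤1⇒≤* : ∀ {u v w} → u ≤ 1 → u ≤ v → u ≤ w → u ≤ v * w
≤1⇒≤* {zero}        _ _ _ = z≤n
≤1⇒≤* {suc zero}    _ p q = *-mono-≤ p q
≤1⇒≤* {suc (suc _)} (s≤s ()) _ _

-- If the coordinatewise minimum of k independent vectors lies in an up-set, so does each of them.
min-power : ∀ a c M n {f} → Bounded f → Increasing f → ∀ k →
            E (a ^ k) (gap a c k) M n f ≤ E a c M n f ^ k
min-power a c M n bd up zero =
  ≤-trans (EL.mono 1 0 M n bd) (≤-reflexive (trans (E-mass 1 0 M n) (1^n^m≡1 M n)))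
min-power a c M n {f} bd up (suc k) = ≤-trans
  (tensor-bound (geo-min a c (a ^ k) (gap a c k) M) n f f f
    λ {_} {_} {z} r → ≤1⇒≤* (bd z) (up (proj₁ ∘ r)) (up (proj₂ ∘ r)))
  (*-monoʳ-≤ (E a c M n f) (min-power a c M n bd up k))

-- The vector of disjunctions dominates each of the k independent vectors, so if it lies in a
-- down-set, all of them do.
max-power : ∀ a c M n {f} → Bounded f → Decreasing f → ∀ k →
            E (gap c a k) (c ^ k) M n f ≤ E a c M n f ^ k
max-power a c M n bd dn zero =
  ≤-trans (EL.mono 0 1 M n bd) (≤-reflexive (trans (E-mass 0 1 M n) (1^n^m≡1 M n)))
max-power a c M n {f} bd dn (suc k) = ≤-trans
  (tensor-bound (geo-max a c (gap c a k) (c ^ k) M) n f f f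
    λ {_} {_} {z} r → ≤1⇒≤* (bd z) (dn (proj₁ ∘ r)) (dn (proj₂ ∘ r)))
  (*-monoʳ-≤ (E a c M n f) (max-power a c M n bd dn k))

-- Distributions of a given size

anti : ℕ → (ℕ → ℕ → ℕ) → ℕ
anti zero    g = g 0 0
anti (suc r) g = g 0 (suc r) + anti r (g ∘ suc)

anti-mono : ∀ r {g h} → (∀ j l → j + l ≡ r → g j l ≤ h j l) → anti r g ≤ anti r h
anti-mono zero    p = p 0 0 refl
anti-mono (suc r) p = +-mono-≤ (p 0 (suc r) refl) (anti-mono r λ j l e → p (suc j) l (cong suc e))

anti-cong : ∀ r {g h} → (∀ j l → j + l ≡ r → g j l ≡ h j l) → anti r g ≡ anti r h
anti-cong r p = ≤-antisym (anti-mono r λ j l e → ≤-reflexive (p j l e))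
                          (anti-mono r λ j l e → ≤-reflexive (sym (p j l e)))

anti-add : ∀ r g h → anti r (λ j l → g j l + h j l) ≡ anti r g + anti r h
anti-add zero    g h = refl
anti-add (suc r) g h = trans (cong (g 0 (suc r) + h 0 (suc r) +_) (anti-add r _ _))
                             (i (g 0 (suc r)) (h 0 (suc r)) (anti r (g ∘ suc)) (anti r (h ∘ suc)))
  where
  i : ∀ x y s t → x + y + (s + t) ≡ x + s + (y + t)
  i = solve-∀

anti-scale : ∀ r k g → anti r (λ j l → k * g j l) ≡ k * anti r g
anti-scale zero    k g = refl
anti-scale (suc r) k g = trans (cong (k * g 0 (suc r) +_) (anti-scale r k _))
                               (sym (*-distribˡ-+ k (g 0 (suc r)) (anti r (g ∘ suc))))

anti-last : ∀ r g → anti (suc r) g ≡ anti r (λ j l → g j (suc l)) + g (suc r) 0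
anti-last zero    g = refl
anti-last (suc r) g = trans (cong (g 0 (2 + r) +_) (anti-last r (g ∘ suc))) (sym (+-assoc (g 0 (2 + r)) _ _))

-- Each term is weighted by r + 1 = l + j. The l-part loses its term at l = 0 and the j-part its
-- term at j = 0, so both shift down to the antidiagonal j + l = r.
anti-step : ∀ r g → suc r * anti (suc r) g ≡
                    anti r (λ j l → suc l * g j (suc l) + suc j * g (suc j) l)
anti-step r g = begin
  suc r * anti (suc r) g
    ≡⟨ anti-scale (suc r) (suc r) g ⟨
  anti (suc r) (λ j l → suc r * g j l)
    ≡⟨ anti-cong (suc r) (λ j l e → trans (cong (_* g j l) (trans (sym e) (+-comm j l)))
         (*-distribʳ-+ (g j l) l j)) ⟩
  anti (suc r) (λ j l → l * g j l + j * g j l)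
    ≡⟨ anti-add (suc r) (λ j l → l * g j l) (λ j l → j * g j l) ⟩
  anti (suc r) (λ j l → l * g j l) + anti r (λ j l → suc j * g (suc j) l)
    ≡⟨ cong (_+ anti r (λ j l → suc j * g (suc j) l)) (trans (anti-last r (λ j l → l * g j l)) (+-identityʳ _)) ⟩
  anti r (λ j l → suc l * g j (suc l)) + anti r (λ j l → suc j * g (suc j) l)
    ≡⟨ anti-add r (λ j l → suc l * g j (suc l)) (λ j l → suc j * g (suc j) l) ⟨
  anti r (λ j l → suc l * g j (suc l) + suc j * g (suc j) l) ∎
  where open ≡-Reasoning

bump : ∀ {n} → Vec ℕ (suc n) → Vec ℕ (suc n)
bump (j ∷ v) = suc j ∷ v

-- The recursion on the size, by whether the first coordinate is 0, mirrors that of `anti` and makes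
-- the two halves of the list disjoint.
comps : ∀ n → ℕ → List (Vec ℕ n)
comps zero    zero    = [] ∷ []
comps zero    (suc r) = []
comps (suc n) zero    = map (0 ∷_) (comps n 0)
comps (suc n) (suc r) = map (0 ∷_) (comps n (suc r)) ++ map bump (comps (suc n) r)

Sum : ∀ n → ℕ → (Vec ℕ n → ℕ) → ℕ
Sum n r f = sumˡ (map f (comps n r))

Num : ℕ → ℕ → ℕ
Num n r = Sum n r (const 1)

sum-map-mono : ∀ {A : Set} {f g : A → ℕ} → (∀ x → f x ≤ g x) → ∀ xs → sumˡ (map f xs) ≤ sumˡ (map g xs)
sum-map-mono p []       = z≤n
sum-map-mono p (x ∷ xs) = +-mono-≤ (p x) (sum-map-mono p xs)

Sum-mono : ∀ n r {f g} → (∀ x → f x ≤ g x) → Sum n r f ≤ Sum n r g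
Sum-mono n r p = sum-map-mono p (comps n r)

Sum-anti : ∀ n r f → Sum (suc n) r f ≡ anti r (λ j l → Sum n l (λ v → f (j ∷ v)))
Sum-anti n zero    f = cong sumˡ (sym (map-∘ (comps n 0)))
Sum-anti n (suc r) f = begin
  sumˡ (map f (map (0 ∷_) (comps n (suc r)) ++ map bump (comps (suc n) r)))
    ≡⟨ cong sumˡ (map-++ f (map (0 ∷_) (comps n (suc r))) _) ⟩
  sumˡ (map f (map (0 ∷_) (comps n (suc r))) ++ map f (map bump (comps (suc n) r)))
    ≡⟨ sum-++ (map f (map (0 ∷_) (comps n (suc r)))) _ ⟩
  sumˡ (map f (map (0 ∷_) (comps n (suc r)))) + sumˡ (map f (map bump (comps (suc n) r)))
    ≡⟨ cong₂ (λ xs ys → sumˡ xs + sumˡ ys) (sym (map-∘ (comps n (suc r)))) (sym (map-∘ (comps (suc n) r))) ⟩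
  Sum n (suc r) (λ v → f (0 ∷ v)) + Sum (suc n) r (f ∘ bump)
    ≡⟨ cong (Sum n (suc r) (λ v → f (0 ∷ v)) +_) (Sum-anti n r (f ∘ bump)) ⟩
  anti (suc r) (λ j l → Sum n l (λ v → f (j ∷ v))) ∎
  where open ≡-Reasoning

-- Pólya's urn: adding a pebble at i with probability (xᵢ + 1) / (r + n) carries the
-- uniform law on size r to the uniform law on size r + 1.
Sum-up : ∀ n r {f} → Increasing f → (r + n) * Sum n r f ≤ suc r * Sum n (suc r) f
Sum-up zero    zero    up = z≤n
Sum-up zero    (suc r) up = ≤-trans (≤-reflexive (*-zeroʳ (suc r + 0))) z≤n
Sum-up (suc n) r {f} up = begin
  (r + suc n) * Sum (suc n) r f               ≡⟨ cong ((r + suc n) *_) (Sum-anti n r f) ⟩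
  (r + suc n) * anti r G                    ≡⟨ anti-scale r (r + suc n) G ⟨
  anti r (λ j l → (r + suc n) * G j l)      ≤⟨ anti-mono r pt ⟩
  anti r (λ j l → suc l * G j (suc l) + suc j * G (suc j) l)  ≡⟨ anti-step r G ⟨
  suc r * anti (suc r) G                    ≡⟨ cong (suc r *_) (Sum-anti n (suc r) f) ⟨
  suc r * Sum (suc n) (suc r) f ∎
  where
  open ≤-Reasoning
  G : ℕ → ℕ → ℕ
  G j l = Sum n l (λ v → f (j ∷ v))
  i : ∀ j l n x → (j + l + (1 + n)) * x ≡ (l + n) * x + (1 + j) * x
  i = solve-∀
  pt : ∀ j l → j + l ≡ r → (r + suc n) * G j l ≤ suc l * G j (suc l) + suc j * G (suc j) l
  -- The urn weight r + n + 1 splits into l + n for a pebble added to the tail and j + 1 for one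
  -- added to the first coordinate.
  pt j l refl = ≤-trans (≤-reflexive (i j l n (G j l))) (+-mono-≤
    (Sum-up n l λ p → up (⊑-∷ ≤-refl p))
    (*-monoʳ-≤ (suc j) (Sum-mono n l λ v → up (⊑-∷ (n≤1+n j) (⊑-refl {x = v})))))

-- The urn argument for the constant 1, where it is an equality. For positive n it is the recursion
-- of the binomial coefficients C(n + r - 1, r).
Num-step : ∀ n r → (r + n) * Num n r ≡ suc r * Num n (suc r)
Num-step zero    zero    = refl
Num-step zero    (suc r) = trans (*-zeroʳ (suc r + 0)) (sym (*-zeroʳ (2 + r)))
Num-step (suc n) r = begin
  (r + suc n) * Num (suc n) r                 ≡⟨ cong ((r + suc n) *_) (Sum-anti n r (const 1)) ⟩
  (r + suc n) * anti r (λ j l → Num n l)      ≡⟨ anti-scale r (r + suc n) (λ _ → Num n) ⟨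
  anti r (λ j l → (r + suc n) * Num n l)      ≡⟨ anti-cong r (λ { j l refl → trans (i j l n (Num n l)) (cong (_+ suc j * Num n l) (Num-step n l)) }) ⟩
  anti r (λ j l → suc l * Num n (suc l) + suc j * Num n l)  ≡⟨ anti-step r (λ _ → Num n) ⟨
  suc r * anti (suc r) (λ j l → Num n l)      ≡⟨ cong (suc r *_) (Sum-anti n (suc r) (const 1)) ⟨
  suc r * Num (suc n) (suc r) ∎
  where
  open ≡-Reasoning
  i : ∀ j l n x → (j + l + (1 + n)) * x ≡ (l + n) * x + (1 + j) * x
  i = solve-∀

Num-pos : ∀ n r .{{_ : NonZero n}} → 0 < Num n r
Num-pos (suc zero)    zero    = s≤s z≤n
Num-pos (suc (suc n)) zero    = subst (0 <_) (sym (Sum-anti (suc n) 0 (const 1))) (Num-pos (suc n) 0)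
Num-pos (suc n)       (suc r) = *-cancelˡ-< (suc r) 0 _ (subst₂ _<_ (sym (*-zeroʳ (suc r))) (Num-step (suc n) r)
  (*-mono-≤ (≤-trans (s≤s z≤n) (m≤n+m (suc n) r)) (Num-pos (suc n) r)))

-- The inequality `Sum-up` divided by the identity `Num-step`.
Sum-density-step : ∀ n r {f} → Increasing f → Sum n r f * Num n (suc r) ≤ Num n r * Sum n (suc r) f
Sum-density-step n r {f} up = *-cancelˡ-≤ (suc r) (begin
  suc r * (A * Num n (suc r))   ≡⟨ i (suc r) A _ ⟩
  A * (suc r * Num n (suc r))   ≡⟨ cong (A *_) (Num-step n r) ⟨
  A * ((r + n) * Num n r)       ≡⟨ j A (r + n) (Num n r) ⟩
  Num n r * ((r + n) * A)       ≤⟨ *-monoʳ-≤ (Num n r) (Sum-up n r up) ⟩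
  Num n r * (suc r * Sum n (suc r) f)  ≡⟨ i (Num n r) (suc r) _ ⟩
  suc r * (Num n r * Sum n (suc r) f) ∎)
  where
  open ≤-Reasoning
  A = Sum n r f
  i : ∀ x y z → x * (y * z) ≡ y * (x * z)
  i = solve-∀
  j : ∀ x y z → x * (y * z) ≡ z * (y * x)
  j = solve-∀

density-mono : ∀ n {f} .{{_ : NonZero n}} → Increasing f → ∀ {r R} → r ≤ R →
               Sum n r f * Num n R ≤ Num n r * Sum n R f
density-mono n {f} up {r} r≤R = go (≤⇒≤′ r≤R)
  where
  open ≤-Reasoning
  i : ∀ x y z → x * (y * z) ≡ y * z * x
  i = solve-∀
  k : ∀ x y z → x * y * z ≡ x * z * y
  k = solve-∀
  go : ∀ {R} → r ≤′ R → Sum n r f * Num n R ≤ Num n r * Sum n R f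
  go ≤′-refl = ≤-reflexive (*-comm (Sum n r f) (Num n r))
  go (≤′-step {R} p) = *-cancelˡ-≤ (Num n R) {{>-nonZero (Num-pos n R)}} (begin
    Num n R * (Sum n r f * Num n (suc R))   ≡⟨ trans (i (Num n R) (Sum n r f) (Num n (suc R))) (k (Sum n r f) (Num n (suc R)) (Num n R)) ⟩
    Sum n r f * Num n R * Num n (suc R)     ≤⟨ *-monoˡ-≤ (Num n (suc R)) (go p) ⟩
    Num n r * Sum n R f * Num n (suc R)     ≡⟨ *-assoc (Num n r) _ _ ⟩
    Num n r * (Sum n R f * Num n (suc R))   ≤⟨ *-monoʳ-≤ (Num n r) (Sum-density-step n R up) ⟩
    Num n r * (Num n R * Sum n (suc R) f)   ≡⟨ trans (sym (*-assoc (Num n r) (Num n R) _)) (trans (cong (_* Sum n (suc R) f) (*-comm (Num n r) (Num n R))) (*-assoc (Num n R) (Num n r) _)) ⟩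
    Num n R * (Num n r * Sum n (suc R) f) ∎)

-- Size levels of the product law

δ : ℕ → ℕ → ℕ
δ zero    zero    = 1
δ zero    (suc s) = 0
δ (suc r) zero    = 0
δ (suc r) (suc s) = δ r s

δ-cancel : ∀ j l s → δ (j + l) (j + s) ≡ δ l s
δ-cancel zero    l s = refl
δ-cancel (suc j) l s = δ-cancel j l s

δ-< : ∀ {r s} → r < s → δ r s ≡ 0
δ-< {zero}  (s≤s _) = refl
δ-< {suc r} (s≤s p) = δ-< p

sum< : ℕ → (ℕ → ℕ) → ℕ
sum< zero    g = 0
sum< (suc M) g = g 0 + sum< M (g ∘ suc)

sum<-mono : ∀ M {g h} → (∀ r → r < M → g r ≤ h r) → sum< M g ≤ sum< M h
sum<-mono zero    p = z≤n
sum<-mono (suc M) p = +-mono-≤ (p 0 (s≤s z≤n)) (sum<-mono M λ r q → p (suc r) (s≤s q))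

sum<-scale : ∀ M k g → sum< M (λ r → k * g r) ≡ k * sum< M g
sum<-scale zero    k g = sym (*-zeroʳ k)
sum<-scale (suc M) k g = trans (cong (k * g 0 +_) (sum<-scale M k (g ∘ suc)))
                               (sym (*-distribˡ-+ k (g 0) _))

sum<-+ : ∀ t d g → sum< (t + d) g ≡ sum< t g + sum< d (λ i → g (t + i))
sum<-+ zero    d g = refl
sum<-+ (suc t) d g = trans (cong (g 0 +_) (sum<-+ t d (g ∘ suc))) (sym (+-assoc (g 0) _ _))

sum<-0 : ∀ M → sum< M (const 0) ≡ 0
sum<-0 zero    = refl
sum<-0 (suc M) = sum<-0 M

sum<-δ≤1 : ∀ M s → sum< M (λ r → δ r s) ≤ 1
sum<-δ≤1 zero    s       = z≤n
sum<-δ≤1 (suc M) zero    = ≤-reflexive (cong suc (sum<-0 M))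
sum<-δ≤1 (suc M) (suc s) = sum<-δ≤1 M s

sum<-δ≡1 : ∀ {M s} → s < M → sum< M (λ r → δ r s) ≡ 1
sum<-δ≡1 {suc M} {zero}  _       = cong suc (sum<-0 M)
sum<-δ≡1 {suc M} {suc s} (s≤s p) = sum<-δ≡1 p

linear-sum< : ∀ {A : Set} {I : (A → ℕ) → ℕ} → Linear I → ∀ M (φ : ℕ → A → ℕ) →
              I (λ x → sum< M (λ r → φ r x)) ≡ sum< M (λ r → I (φ r))
linear-sum< L zero    φ = Linear.I-const L 0
linear-sum< {I = I} L (suc M) φ = trans (Linear.add L (φ 0) _)
  (cong (I (φ 0) +_) (linear-sum< L M (φ ∘ suc)))

-- A value j < M has weight c a^j (a + c)^(M - 1 - j); the factor (a + c)^(r + 1) clears the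
-- negative exponents. Since φ vanishes above r, the atom at M, whose weight has another form, does
-- not enter.
geo-anti : ∀ a c {M} r {φ} → r < M → (∀ j → r < j → φ j ≡ 0) →
           (a + c) ^ suc r * geo a c M φ ≡ c * (a + c) ^ M * anti r (λ j l → a ^ j * (a + c) ^ l * φ j)
geo-anti a c {suc M} zero {φ} _ φ≡0 = begin
  b * 1 * (c * p * φ 0 + a * geo a c M (φ ∘ suc))
    ≡⟨ cong (λ t → b * 1 * (c * p * φ 0 + a * t))
         (trans (Geo.ext a c M (λ j → φ≡0 (suc j) (s≤s z≤n))) (Geo.I-const a c M 0)) ⟩
  b * 1 * (c * p * φ 0 + a * 0)  ≡⟨ i b c p (φ 0) a ⟩
  c * (b * p) * (1 * 1 * φ 0) ∎
  where
  open ≡-Reasoning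
  b = a + c
  p = b ^ M
  i : ∀ b c p x a → b * 1 * (c * p * x + a * 0) ≡ c * (b * p) * (1 * 1 * x)
  i = solve-∀
geo-anti a c {suc M} (suc r) {φ} (s≤s r<M) φ≡0 = begin
  b * q * (c * p * φ 0 + a * geo a c M (φ ∘ suc))
    ≡⟨ i₁ b q c p (φ 0) a (geo a c M (φ ∘ suc)) ⟩
  c * (b * p) * (1 * q * φ 0) + a * b * (q * geo a c M (φ ∘ suc))
    ≡⟨ cong (λ t → c * (b * p) * (1 * q * φ 0) + a * b * t)
         (geo-anti a c r r<M (λ j r<j → φ≡0 (suc j) (s≤s r<j))) ⟩
  c * (b * p) * (1 * q * φ 0) + a * b * (c * p * anti r (λ j l → a ^ j * b ^ l * φ (suc j)))
    ≡⟨ i₂ b c p (1 * q * φ 0) a (anti r (λ j l → a ^ j * b ^ l * φ (suc j))) ⟩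
  c * (b * p) * (1 * q * φ 0 + a * anti r (λ j l → a ^ j * b ^ l * φ (suc j)))
    ≡⟨ cong (λ t → c * (b * p) * (1 * q * φ 0 + t)) (trans (sym (anti-scale r a _))
         (anti-cong r (λ j l _ → i₃ a (a ^ j) (b ^ l) (φ (suc j))))) ⟩
  c * (b * p) * (1 * q * φ 0 + anti r (λ j l → a * a ^ j * b ^ l * φ (suc j))) ∎
  where
  open ≡-Reasoning
  b = a + c
  p = b ^ M
  q = b ^ suc r
  i₁ : ∀ b q c p x a t → b * q * (c * p * x + a * t) ≡ c * (b * p) * (1 * q * x) + a * b * (q * t)
  i₁ = solve-∀
  i₂ : ∀ b c p x a t → c * (b * p) * x + a * b * (c * p * t) ≡ c * (b * p) * (x + a * t)
  i₂ = solve-∀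
  i₃ : ∀ a u v x → a * (u * v * x) ≡ a * u * v * x
  i₃ = solve-∀

level : ℕ → ℕ → ℕ → ∀ n → (Vec ℕ n → ℕ) → ℕ → ℕ
level a c M n f r = E a c M n (λ v → f v * δ r (total v))

-- Under the geometric law all vectors of a given size r < M are equally likely.
level-uniform : ∀ a c M n r f → r < M →
  (a + c) ^ (n + r) * level a c M n f r ≡ c ^ n * a ^ r * ((a + c) ^ M) ^ n * Sum n r f
level-uniform a c M zero zero    f _ = i (f [])
  where
  i : ∀ x → 1 * (x * 1) ≡ 1 * 1 * 1 * (x + 0)
  i = solve-∀
level-uniform a c M zero (suc r) f _ = trans (cong ((a + c) ^ suc r *_) (*-zeroʳ (f [])))
  (trans (*-zeroʳ ((a + c) ^ suc r)) (sym (*-zeroʳ (1 * a ^ suc r * 1))))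
level-uniform a c M (suc n) r f r<M = begin
  b ^ (suc n + r) * geo a c M φ
    ≡⟨ cong (_* geo a c M φ) (trans (cong (b ^_) (sym (+-suc n r))) (^-distribˡ-+-* b n (suc r))) ⟩
  b ^ n * b ^ suc r * geo a c M φ
    ≡⟨ *-assoc (b ^ n) _ _ ⟩
  b ^ n * (b ^ suc r * geo a c M φ)
    ≡⟨ cong (b ^ n *_) (geo-anti a c r r<M φ-vanish) ⟩
  b ^ n * (c * p * anti r (λ j l → a ^ j * b ^ l * φ j))
    ≡⟨ i₁ (b ^ n) (c * p) _ ⟩
  c * p * (b ^ n * anti r (λ j l → a ^ j * b ^ l * φ j))
    ≡⟨ cong (c * p *_) (trans (sym (anti-scale r (b ^ n) _)) (anti-cong r pt)) ⟩
  c * p * anti r (λ j l → c ^ n * a ^ r * Z * Sum n l (λ v → f (j ∷ v)))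
    ≡⟨ cong (c * p *_) (trans (anti-scale r (c ^ n * a ^ r * Z) _) (cong (c ^ n * a ^ r * Z *_) (sym (Sum-anti n r f)))) ⟩
  c * p * (c ^ n * a ^ r * Z * Sum (suc n) r f)
    ≡⟨ i₂ c p (c ^ n) (a ^ r) Z (Sum (suc n) r f) ⟩
  c * c ^ n * a ^ r * (p * Z) * Sum (suc n) r f ∎
  where
  open ≡-Reasoning
  b = a + c
  p = b ^ M
  Z = (b ^ M) ^ n
  φ : ℕ → ℕ
  φ j = E a c M n (λ v → f (j ∷ v) * δ r (j + total v))
  φ-vanish : ∀ j → r < j → φ j ≡ 0
  φ-vanish j r<j = trans (EL.ext a c M n λ v → trans
      (cong (f (j ∷ v) *_) (δ-< (≤-trans r<j (m≤m+n j (total v))))) (*-zeroʳ (f (j ∷ v))))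
    (EL.I-const a c M n 0)
  i₁ : ∀ x y z → x * (y * z) ≡ y * (x * z)
  i₁ = solve-∀
  i₂ : ∀ c p x y z s → c * p * (x * y * z * s) ≡ c * x * y * (p * z) * s
  i₂ = solve-∀
  i₃ : ∀ x y z w → x * (y * z * w) ≡ y * (x * z * w)
  i₃ = solve-∀
  i₄ : ∀ x y z w s → x * (y * z * w * s) ≡ y * (x * z) * w * s
  i₄ = solve-∀
  pt : ∀ j l → j + l ≡ r → b ^ n * (a ^ j * b ^ l * φ j) ≡ c ^ n * a ^ r * Z * Sum n l (λ v → f (j ∷ v))
  pt j l refl = begin
    b ^ n * (a ^ j * b ^ l * φ j)
      ≡⟨ i₃ (b ^ n) (a ^ j) (b ^ l) (φ j) ⟩
    a ^ j * (b ^ n * b ^ l * φ j)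
      ≡⟨ cong₂ (λ x y → a ^ j * (x * y)) (sym (^-distribˡ-+-* b n l))
           (EL.ext a c M n λ v → cong (f (j ∷ v) *_) (δ-cancel j l (total v))) ⟩
    a ^ j * (b ^ (n + l) * level a c M n (λ v → f (j ∷ v)) l)
      ≡⟨ cong (a ^ j *_) (level-uniform a c M n l _ (≤-trans (s≤s (m≤n+m l j)) r<M)) ⟩
    a ^ j * (c ^ n * a ^ l * Z * Sum n l (λ v → f (j ∷ v)))
      ≡⟨ i₄ (a ^ j) (c ^ n) (a ^ l) Z _ ⟩
    c ^ n * (a ^ j * a ^ l) * Z * Sum n l (λ v → f (j ∷ v))
      ≡⟨ cong (λ x → c ^ n * x * Z * Sum n l (λ v → f (j ∷ v))) (^-distribˡ-+-* a j l) ⟨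
    c ^ n * a ^ (j + l) * Z * Sum n l (λ v → f (j ∷ v)) ∎

module Levels (a c M n : ℕ) .{{_ : NonZero (a + c)}} .{{_ : NonZero n}} where
  open ≤-Reasoning
  private
    b = a + c
    T = E a c M n
    lev = level a c M n
    ones : Vec ℕ n → ℕ
    ones = const 1

  Z : ℕ
  Z = (b ^ M) ^ n

  -- The factor in `level-uniform` does not depend on f. Hence, conditionally on size r, the
  -- probability of f is its density among the vectors of size r.
  level-density : ∀ f {r} → r < M → lev f r * Num n r ≡ lev ones r * Sum n r f
  level-density f {r} r<M = *-cancelˡ-≡ _ _ (b ^ (n + r)) {{m^n≢0 b (n + r)}} (begin-equality
    b ^ (n + r) * (lev f r * Num n r)     ≡⟨ *-assoc (b ^ (n + r)) _ _ ⟨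
    b ^ (n + r) * lev f r * Num n r       ≡⟨ cong (_* Num n r) (level-uniform a c M n r f r<M) ⟩
    w * Sum n r f * Num n r                 ≡⟨ i w (Sum n r f) (Num n r) ⟩
    w * Num n r * Sum n r f                 ≡⟨ cong (_* Sum n r f) (level-uniform a c M n r ones r<M) ⟨
    b ^ (n + r) * lev ones r * Sum n r f  ≡⟨ *-assoc (b ^ (n + r)) _ _ ⟩
    b ^ (n + r) * (lev ones r * Sum n r f) ∎)
    where
    w = c ^ n * a ^ r * Z
    i : ∀ x y z → x * y * z ≡ x * z * y
    i = solve-∀

  sum-level≤ : ∀ f → sum< M (lev f) ≤ T f
  sum-level≤ f = begin
    sum< M (lev f)                                    ≡⟨ linear-sum< (E-linear a c M n) M _ ⟨
    T (λ v → sum< M (λ r → f v * δ r (total v)))      ≤⟨ EL.mono a c M n pt ⟩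
    T f ∎
    where
    pt : ∀ v → sum< M (λ r → f v * δ r (total v)) ≤ f v
    pt v = begin
      sum< M (λ r → f v * δ r (total v))  ≡⟨ sum<-scale M (f v) _ ⟩
      f v * sum< M (λ r → δ r (total v))  ≤⟨ *-monoʳ-≤ (f v) (sum<-δ≤1 M (total v)) ⟩
      f v * 1                             ≡⟨ *-identityʳ (f v) ⟩
      f v ∎

  -- Markov's inequality for the event that the size is at least M.
  markov : ∀ {f} → Bounded f → M * T f ≤ M * sum< M (lev f) + T total
  markov {f} bd = begin
    M * T f
      ≡⟨ EL.scale a c M n M f ⟨
    T (λ v → M * f v)
      ≤⟨ EL.mono a c M n pt ⟩
    T (λ v → M * sum< M (λ r → f v * δ r (total v)) + total v)
      ≡⟨ trans (EL.add a c M n _ total) (cong (_+ T total) (trans (EL.scale a c M n M _)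
           (cong (M *_) (linear-sum< (E-linear a c M n) M _)))) ⟩
    M * sum< M (lev f) + T total ∎
    where
    pt : ∀ v → M * f v ≤ M * sum< M (λ r → f v * δ r (total v)) + total v
    pt v with total v <? M
    ... | yes s<M = begin
      M * f v
        ≡⟨ cong (M *_) (trans (sum<-scale M (f v) _) (trans (cong (f v *_) (sum<-δ≡1 s<M)) (*-identityʳ (f v)))) ⟨
      M * sum< M (λ r → f v * δ r (total v))
        ≤⟨ m≤m+n _ (total v) ⟩
      M * sum< M (λ r → f v * δ r (total v)) + total v ∎
    ... | no s≮M = begin
      M * f v  ≤⟨ *-monoʳ-≤ M (bd v) ⟩
      M * 1    ≡⟨ *-identityʳ M ⟩
      M        ≤⟨ ≮⇒≥ s≮M ⟩
      total v  ≤⟨ m≤n+m (total v) _ ⟩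
      M * sum< M (λ r → f v * δ r (total v)) + total v ∎

  -- By `level-uniform` and `Num-step` the masses of sizes r + 1 and r have ratio a (r + n) / ((a +
  -- c) (r + 1)).
  level-increasing : ∀ {r} → suc r < M → b * suc r ≤ a * (r + n) → lev ones r ≤ lev ones (suc r)
  level-increasing {r} r<M h = *-cancelˡ-≤ (suc r) (*-cancelˡ-≤ (b ^ (n + suc r)) {{m^n≢0 b (n + suc r)}} (begin
    b ^ (n + suc r) * (suc r * lev ones r)
      ≡⟨ cong (λ e → b ^ e * (suc r * lev ones r)) (+-suc n r) ⟩
    b * b ^ (n + r) * (suc r * lev ones r)
      ≡⟨ i₁ b (b ^ (n + r)) (suc r) _ ⟩
    b * suc r * (b ^ (n + r) * lev ones r)
      ≡⟨ cong (b * suc r *_) (level-uniform a c M n r ones (≤-trans (n≤1+n _) r<M)) ⟩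
    b * suc r * (c ^ n * a ^ r * Z * Num n r)
      ≤⟨ *-monoˡ-≤ (c ^ n * a ^ r * Z * Num n r) h ⟩
    a * (r + n) * (c ^ n * a ^ r * Z * Num n r)
      ≡⟨ i₂ a (r + n) (c ^ n) (a ^ r) Z (Num n r) ⟩
    c ^ n * (a * a ^ r) * Z * ((r + n) * Num n r)
      ≡⟨ cong (c ^ n * (a * a ^ r) * Z *_) (Num-step n r) ⟩
    c ^ n * (a * a ^ r) * Z * (suc r * Num n (suc r))
      ≡⟨ i₃ (c ^ n * (a * a ^ r) * Z) (suc r) _ ⟩
    suc r * (c ^ n * (a * a ^ r) * Z * Num n (suc r))
      ≡⟨ cong (suc r *_) (level-uniform a c M n (suc r) ones r<M) ⟨
    suc r * (b ^ (n + suc r) * lev ones (suc r))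
      ≡⟨ i₃ (suc r) (b ^ (n + suc r)) _ ⟩
    b ^ (n + suc r) * (suc r * lev ones (suc r)) ∎))
    where
    i₁ : ∀ x y z w → x * y * (z * w) ≡ x * z * (y * w)
    i₁ = solve-∀
    i₂ : ∀ a s x y z t → a * s * (x * y * z * t) ≡ x * (a * y) * z * (s * t)
    i₂ = solve-∀
    i₃ : ∀ x y z → x * (y * z) ≡ y * (x * z)
    i₃ = solve-∀

  -- Sizes below t are no likelier than those in [t, 2t), so sizes in [t, M) carry at
  -- least a quarter of the mass.
  mass≤ : ∀ {f t d q} → Increasing f → M ≡ t + d → t ≤ d → 0 < M →
          a + c * (2 * t) ≤ a * n → 2 * T total ≤ M * Z →
          Num n t ≤ q * Sum n t f → Z ≤ 4 * q * T f
  mass≤ {f} {t} {d} {q} up refl t≤d 0<M h tail dense =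
    *-cancelˡ-≤ M {{>-nonZero 0<M}} (+-cancelʳ-≤ (M * Z) _ _ (begin
      M * Z + M * Z                        ≡⟨ i₁ (M * Z) ⟩
      2 * (M * Z)                          ≡⟨ cong (λ z → 2 * (M * z)) (E-mass a c M n) ⟨
      -- The factor 4 q: by Markov at least half the mass lies below M, at least half of that on
      -- sizes from t on, and at those sizes f has density at least 1 / q.
      2 * (M * T ones)                     ≤⟨ *-monoʳ-≤ 2 (markov (λ _ → ≤-refl)) ⟩
      2 * (M * sum< M (lev ones) + T total)
        ≤⟨ *-monoʳ-≤ 2 (+-monoˡ-≤ (T total) (*-monoʳ-≤ M below)) ⟩
      2 * (M * (2 * (q * T f)) + T total)  ≡⟨ i₂ M q (T f) (T total) ⟩
      M * (4 * q * T f) + 2 * T total      ≤⟨ +-monoʳ-≤ _ tail ⟩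
      M * (4 * q * T f) + M * Z ∎))
    where
    i₁ : ∀ x → x + x ≡ 2 * x
    i₁ = solve-∀
    i₂ : ∀ m q e s → 2 * (m * (2 * (q * e)) + s) ≡ m * (4 * q * e) + 2 * s
    i₂ = solve-∀
    i₃ : ∀ a c r → (a + c) * (1 + r) ≡ a * r + (a + c * (1 + r))
    i₃ = solve-∀
    tail-mono : ∀ {k l} g → k ≤ l → sum< k g ≤ sum< l g
    tail-mono g z≤n     = z≤n
    tail-mono g (s≤s p) = +-monoʳ-≤ (g 0) (tail-mono (g ∘ suc) p)
    2t≤M : 2 * t ≤ M
    2t≤M = ≤-trans (≤-reflexive (cong (t +_) (+-identityʳ t))) (+-monoʳ-≤ t t≤d)
    ascending : ∀ {r s} → r ≤′ s → s < 2 * t → lev ones r ≤ lev ones s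
    ascending ≤′-refl       _  = ≤-refl
    ascending (≤′-step {s} p) s<2t = ≤-trans (ascending p (≤-trans (n≤1+n _) s<2t))
      (level-increasing (≤-trans s<2t 2t≤M) (begin
        b * suc s                    ≡⟨ i₃ a c s ⟩
        a * s + (a + c * suc s)      ≤⟨ +-monoʳ-≤ (a * s) (+-monoʳ-≤ a (*-monoʳ-≤ c (≤-trans (n≤1+n _) s<2t))) ⟩
        a * s + (a + c * (2 * t))    ≤⟨ +-monoʳ-≤ (a * s) h ⟩
        a * s + a * n                ≡⟨ *-distribˡ-+ a s n ⟨
        a * (s + n) ∎))
    -- Pólya's urn carries the density 1 / q from size t up to size r, and `level-density` transfers
    -- it to the product law.
    dense-level : ∀ r → t ≤ r → r < M → lev ones r ≤ q * lev f r
    dense-level r t≤r r<M = *-cancelˡ-≤ (Num n t * Num n r)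
      {{>-nonZero (*-mono-≤ (Num-pos n t) (Num-pos n r))}} (begin
        Num n t * Num n r * lev ones r           ≤⟨ *-monoˡ-≤ (lev ones r) (*-monoˡ-≤ (Num n r) dense) ⟩
        q * Sum n t f * Num n r * lev ones r     ≡⟨ j₁ q (Sum n t f) (Num n r) (lev ones r) ⟩
        q * (Sum n t f * Num n r * lev ones r)   ≤⟨ *-monoʳ-≤ q (*-monoˡ-≤ (lev ones r) (density-mono n up t≤r)) ⟩
        q * (Num n t * Sum n r f * lev ones r)   ≡⟨ j₂ q (Num n t) (Sum n r f) (lev ones r) ⟩
        q * (Num n t * (lev ones r * Sum n r f)) ≡⟨ cong (λ e → q * (Num n t * e)) (level-density f r<M) ⟨
        q * (Num n t * (lev f r * Num n r))      ≡⟨ j₃ q (Num n t) (lev f r) (Num n r) ⟩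
        Num n t * Num n r * (q * lev f r) ∎)
      where
      j₁ : ∀ q x y z → q * x * y * z ≡ q * (x * y * z)
      j₁ = solve-∀
      j₂ : ∀ q x y z → q * (x * y * z) ≡ q * (x * (z * y))
      j₂ = solve-∀
      j₃ : ∀ q x y z → q * (x * (y * z)) ≡ x * z * (q * y)
      j₃ = solve-∀
    upper = sum< d (λ i → lev ones (t + i))
    below : sum< M (lev ones) ≤ 2 * (q * T f)
    below = begin
      sum< M (lev ones)            ≡⟨ sum<-+ t d (lev ones) ⟩
      sum< t (lev ones) + upper
        -- Size i < t is matched with size t + i < 2 t, where `ascending` applies; t ≤ d keeps the
        -- partner below M.
        ≤⟨ +-monoˡ-≤ upper (≤-trans
             (sum<-mono t λ i i<t → ascending (≤⇒≤′ (m≤n+m i t))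
               (≤-trans (+-monoʳ-< t i<t) (≤-reflexive (cong (t +_) (sym (+-identityʳ t))))))
             (tail-mono _ t≤d)) ⟩
      upper + upper                ≡⟨ i₁ upper ⟩
      2 * upper
        ≤⟨ *-monoʳ-≤ 2 (sum<-mono d λ i i<d → dense-level (t + i) (m≤m+n t i) (+-monoʳ-< t i<d)) ⟩
      2 * sum< d (λ i → q * lev f (t + i))
        ≡⟨ cong (2 *_) (sum<-scale d q _) ⟩
      2 * (q * sum< d (λ i → lev f (t + i)))
        ≤⟨ *-monoʳ-≤ 2 (*-monoʳ-≤ q (≤-trans (m≤n+m _ (sum< t (lev f)))
             (≤-reflexive (sym (sum<-+ t d (lev f)))))) ⟩
      2 * (q * sum< M (lev f))     ≤⟨ *-monoʳ-≤ 2 (*-monoʳ-≤ q (sum-level≤ f)) ⟩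
      2 * (q * T f) ∎

  -- Among sizes below M = R + 1 the density of f is largest at R, so it bounds the probability of f
  -- restricted to these sizes. What is missing from 1 is at most 1 / (2 (m + 1)) for sizes from M
  -- on, by Markov, and as much again for g.
  density≥ : ∀ {f g R m} → M ≡ suc R → Bounded f → Increasing f → (∀ x → f x + g x ≡ 1) →
             2 * suc m * T total ≤ M * Z → 2 * suc m * T g ≤ Z →
             m * Num n R ≤ suc m * Sum n R f
  density≥ {f} {g} {R} {m} refl bd up f+g tail few =
    +-cancelʳ-≤ (Num n R) _ _ (*-cancelˡ-≤ (2 * (M * Z)) {{nz}} (begin
      2 * (M * Z) * (m * Num n R + Num n R)
        ≡⟨ i₁ M Z m (Num n R) ⟩
      2 * suc m * (Num n R * (M * Z))
        ≡⟨ cong (λ z → 2 * suc m * (Num n R * (M * z))) Z≡ ⟩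
      2 * suc m * (Num n R * (M * (T f + T g)))
        ≡⟨ cong (2 * suc m *_) (i₂ (Num n R) M (T f) (T g)) ⟩
      2 * suc m * (Num n R * (M * T f) + Num n R * M * T g)
        ≤⟨ *-monoʳ-≤ (2 * suc m) (+-monoˡ-≤ _ (≤-trans (*-monoʳ-≤ (Num n R) (markov bd))
             (≤-trans (≤-reflexive (i₃ (Num n R) M _ (T total)))
               (+-monoˡ-≤ (Num n R * T total) (*-monoʳ-≤ M sparse))))) ⟩
      2 * suc m * (M * (Sum n R f * Z) + Num n R * T total + Num n R * M * T g)
        ≡⟨ i₄ (2 * suc m) M (Sum n R f) Z (Num n R) (T total) (T g) ⟩
      2 * suc m * (M * (Sum n R f * Z)) + (Num n R * (2 * suc m * T total) + Num n R * M * (2 * suc m * T g))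
        ≤⟨ +-monoʳ-≤ (2 * suc m * (M * (Sum n R f * Z))) (+-mono-≤ (*-monoʳ-≤ (Num n R) tail) (*-monoʳ-≤ (Num n R * M) few)) ⟩
      2 * suc m * (M * (Sum n R f * Z)) + (Num n R * (M * Z) + Num n R * M * Z)
        ≡⟨ i₅ m M (Sum n R f) Z (Num n R) ⟩
      2 * (M * Z) * (suc m * Sum n R f + Num n R) ∎))
    where
    ones-split = trans (sym (EL.ext a c M n f+g)) (EL.add a c M n f g)
    Z≡ : Z ≡ T f + T g
    Z≡ = trans (sym (E-mass a c M n)) ones-split
    Z≢0 : NonZero Z
    Z≢0 = m^n≢0 (b ^ M) n {{m^n≢0 b M}}
    nz : NonZero (2 * (M * Z))
    nz = m*n≢0 2 (M * Z) {{_}} {{m*n≢0 M Z {{_}} {{Z≢0}}}}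
    sparse : Num n R * sum< M (lev f) ≤ Sum n R f * Z
    sparse = begin
      Num n R * sum< M (lev f)           ≡⟨ sum<-scale M (Num n R) (lev f) ⟨
      sum< M (λ r → Num n R * lev f r)   ≤⟨ sum<-mono M pt ⟩
      sum< M (λ r → Sum n R f * lev ones r)  ≡⟨ sum<-scale M (Sum n R f) (lev ones) ⟩
      Sum n R f * sum< M (lev ones)      ≤⟨ *-monoʳ-≤ (Sum n R f) (≤-trans (sum-level≤ ones) (≤-reflexive (E-mass a c M n))) ⟩
      Sum n R f * Z ∎
      where
      j₁ : ∀ x y z → x * (y * z) ≡ y * (z * x)
      j₁ = solve-∀
      j₂ : ∀ x y z → x * y * z ≡ x * (y * z)
      j₂ = solve-∀
      j₃ : ∀ x y z → x * (y * z) ≡ y * (z * x)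
      j₃ = solve-∀
      pt : ∀ r → r < M → Num n R * lev f r ≤ Sum n R f * lev ones r
      pt r r<M@(s≤s r≤R) = *-cancelˡ-≤ (Num n r) {{>-nonZero (Num-pos n r)}} (begin
        Num n r * (Num n R * lev f r)        ≡⟨ j₁ (Num n r) (Num n R) (lev f r) ⟩
        Num n R * (lev f r * Num n r)        ≡⟨ cong (Num n R *_) (level-density f r<M) ⟩
        Num n R * (lev ones r * Sum n r f)   ≡⟨ j₁ (Num n R) (lev ones r) (Sum n r f) ⟩
        lev ones r * (Sum n r f * Num n R)   ≤⟨ *-monoʳ-≤ (lev ones r) (density-mono n up r≤R) ⟩
        lev ones r * (Num n r * Sum n R f)   ≡⟨ j₁ (lev ones r) (Num n r) (Sum n R f) ⟩
        Num n r * (Sum n R f * lev ones r) ∎)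
    i₁ : ∀ M Z m x → 2 * (M * Z) * (m * x + x) ≡ 2 * (1 + m) * (x * (M * Z))
    i₁ = solve-∀
    i₂ : ∀ x M u v → x * (M * (u + v)) ≡ x * (M * u) + x * M * v
    i₂ = solve-∀
    i₃ : ∀ x M u v → x * (M * u + v) ≡ M * (x * u) + x * v
    i₃ = solve-∀
    i₄ : ∀ k M s Z x u v → k * (M * (s * Z) + x * u + x * M * v) ≡ k * (M * (s * Z)) + (x * (k * u) + x * M * (k * v))
    i₄ = solve-∀
    i₅ : ∀ m M s Z x → 2 * (1 + m) * (M * (s * Z)) + (x * (M * Z) + x * M * Z) ≡ 2 * (M * Z) * ((1 + m) * s + x)
    i₅ = solve-∀

-- Amplification

bernoulli : ∀ x k → x ^ k * (x + k) ≤ suc x ^ k * x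
bernoulli x zero    = ≤-reflexive (cong (1 *_) (+-identityʳ x))
bernoulli x (suc k) = begin
  x * x ^ k * (x + suc k)              ≤⟨ m≤m+n _ (x ^ k * k) ⟩
  x * x ^ k * (x + suc k) + x ^ k * k  ≡⟨ i x (x ^ k) k ⟩
  suc x * (x ^ k * (x + k))            ≤⟨ *-monoʳ-≤ (suc x) (bernoulli x k) ⟩
  suc x * (suc x ^ k * x)              ≡⟨ *-assoc (suc x) (suc x ^ k) x ⟨
  suc x * suc x ^ k * x ∎
  where
  open ≤-Reasoning
  i : ∀ x p k → x * p * (x + (1 + k)) + p * k ≡ (1 + x) * (p * (x + k))
  i = solve-∀

-- (x / (x + 1)) ^ (x y) ≤ 1 / (y + 1)
power-decay : ∀ x y .{{_ : NonZero x}} → suc y * x ^ (x * y) ≤ suc x ^ (x * y)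
power-decay x y = *-cancelʳ-≤ _ _ x (begin
  suc y * x ^ (x * y) * x        ≡⟨ i x y (x ^ (x * y)) ⟩
  x ^ (x * y) * (x + x * y)      ≤⟨ bernoulli x (x * y) ⟩
  suc x ^ (x * y) * x ∎)
  where
  open ≤-Reasoning
  i : ∀ x y p → (1 + y) * p * x ≡ p * (x + x * y)
  i = solve-∀

-- With u / z as a probability of at most x / (x + 1), `power-decay` shows that its power x y is at
-- most 1 / (y + 1). The bound on w is meant to come from `min-power` or `max-power`.
amplify : ∀ x y {u w z} .{{_ : NonZero x}} → suc x * u ≤ x * z → w ≤ u ^ (x * y) →
          suc y * w ≤ z ^ (x * y)
amplify x y {u} {w} {z} h w≤ = *-cancelˡ-≤ (x ^ k) {{m^n≢0 x k}} (begin
  x ^ k * (suc y * w)   ≡⟨ i (x ^ k) (suc y) w ⟩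
  suc y * x ^ k * w     ≤⟨ *-mono-≤ (power-decay x y) w≤ ⟩
  suc x ^ k * u ^ k     ≡⟨ ^-distribʳ-* (suc x) u k ⟨
  (suc x * u) ^ k       ≤⟨ ^-monoˡ-≤ k h ⟩
  (x * z) ^ k           ≡⟨ ^-distribʳ-* x z k ⟩
  x ^ k * z ^ k ∎)
  where
  open ≤-Reasoning
  k = x * y
  i : ∀ p s w → p * (s * w) ≡ s * p * w
  i = solve-∀

-- The hypothesis and `gap-upper` give 1 - s^k ≤ 1/2, hence 1 - s^k ≤ s^k, for s = a / (a + c).
gap≤pow : ∀ a c k .{{_ : NonZero (a + c)}} → 2 * (k * c) ≤ a + c → gap a c k ≤ a ^ k
gap≤pow a c k h = +-cancelʳ-≤ (gap a c k) _ _ (*-cancelˡ-≤ (a + c) (begin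
  (a + c) * (gap a c k + gap a c k)     ≡⟨ i (a + c) (gap a c k) ⟩
  2 * ((a + c) * gap a c k)             ≤⟨ *-monoʳ-≤ 2 (gap-upper a c k) ⟩
  2 * (k * c * (a + c) ^ k)             ≡⟨ *-assoc 2 (k * c) _ ⟨
  2 * (k * c) * (a + c) ^ k             ≤⟨ *-monoˡ-≤ ((a + c) ^ k) h ⟩
  (a + c) * (a + c) ^ k                 ≡⟨ cong ((a + c) *_) (pow+gap a c k) ⟨
  (a + c) * (a ^ k + gap a c k) ∎))
  where
  open ≤-Reasoning
  i : ∀ b g → b * (g + g) ≡ 2 * (b * g)
  i = solve-∀

mass-power : ∀ b M n k → ((b ^ k) ^ M) ^ n ≡ ((b ^ M) ^ n) ^ k
mass-power b M n k = begin-equality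
  ((b ^ k) ^ M) ^ n   ≡⟨ cong (_^ n) (swap b k M) ⟩
  ((b ^ M) ^ k) ^ n   ≡⟨ swap (b ^ M) k n ⟩
  ((b ^ M) ^ n) ^ k ∎
  where
  open ≤-Reasoning
  swap : ∀ b k M → (b ^ k) ^ M ≡ (b ^ M) ^ k
  swap b k M = trans (^-*-assoc b k M) (trans (cong (b ^_) (*-comm k M)) (sym (^-*-assoc b M k)))

-- By `E-total` the mean size is at most n a / c. The conclusion is the input to Markov's inequality
-- in `mass≤` and `density≥`.
tail≤ : ∀ a c M n k .{{_ : NonZero c}} → k * (n * a) ≤ M * c →
        k * E a c M n total ≤ M * ((a + c) ^ M) ^ n
tail≤ a c M n k h = *-cancelˡ-≤ c (begin
  c * (k * E a c M n total)      ≡⟨ i c k _ ⟩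
  k * (c * E a c M n total)      ≤⟨ *-monoʳ-≤ k (E-total a c M n) ⟩
  k * (n * a * Z)                ≡⟨ *-assoc k (n * a) Z ⟨
  k * (n * a) * Z                ≤⟨ *-monoˡ-≤ Z h ⟩
  M * c * Z                      ≡⟨ j M c Z ⟩
  c * (M * Z) ∎)
  where
  open ≤-Reasoning
  Z = ((a + c) ^ M) ^ n
  i : ∀ x y z → x * (y * z) ≡ y * (x * z)
  i = solve-∀
  j : ∀ x y z → x * y * z ≡ y * (x * z)
  j = solve-∀

module Amplification (m : ℕ) where

  open ≤-Reasoning

  q = suc m
  -- By power-decay (1 − 1/(4q)) ^ j ≤ 1/(2q) and (1 − 1/(2q)) ^ k ≤ 1/(4q + 1).
  j = (3 + 4 * m) * (1 + 2 * m)
  k = (1 + 2 * m) * (4 * q)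
  -- The first summand serves `sparse-case` and the second `dense-case`, where 1 + 8 j is the cost
  -- of rounding t / n up to an integer.
  K = 16 * q * j + 16 * q * k * (1 + 8 * j)

  4q≡ : 4 * q ≡ suc (3 + 4 * m)
  4q≡ = i m
    where
    i : ∀ m → 4 * (1 + m) ≡ 1 + (3 + 4 * m)
    i = solve-∀

  2q≡ : 2 * q ≡ suc (1 + 2 * m)
  2q≡ = i m
    where
    i : ∀ m → 2 * (1 + m) ≡ 1 + (1 + 2 * m)
    i = solve-∀

  module _ {n t R : ℕ} {f : Vec ℕ n → ℕ} (2≤n : 2 ≤ n) (1≤t : 1 ≤ t) (Kt≤R : K * t ≤ R)
           (bd : Bounded f) (up : Increasing f) (dense : Num n t ≤ q * Sum n t f) where

    private
      instance
        n≢0 : NonZero n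
        n≢0 = >-nonZero (≤-trans (s≤s z≤n) 2≤n)
        t≢0 : NonZero t
        t≢0 = >-nonZero 1≤t

      g : Vec ℕ n → ℕ
      g x = 1 ∸ f x

      bd-g : Bounded g
      bd-g x = m∸n≤m 1 (f x)

      down-g : Decreasing g
      down-g p = ∸-monoʳ-≤ 1 (up p)

      f+g : ∀ x → f x + g x ≡ 1
      f+g x = m+[n∸m]≡n (bd x)

      M = suc R

      Kt≤M : K * t ≤ M
      Kt≤M = ≤-trans Kt≤R (n≤1+n R)

      sparse≤M : 16 * q * j * t ≤ M
      sparse≤M = ≤-trans (*-monoˡ-≤ t (m≤m+n (16 * q * j) (16 * q * k * (1 + 8 * j)))) Kt≤M

      dense≤M : 16 * q * k * (1 + 8 * j) * t ≤ M
      dense≤M = ≤-trans (*-monoˡ-≤ t (m≤n+m (16 * q * k * (1 + 8 * j)) (16 * q * j))) Kt≤M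

      16t≤M : 16 * t ≤ M
      16t≤M = ≤-trans (*-monoˡ-≤ t (≤-trans (m≤m*n 16 (q * j)) (≤-reflexive (sym (*-assoc 16 q j))))) sparse≤M

      M≡ : M ≡ t + (M ∸ t)
      M≡ = sym (m+[n∸m]≡n (≤-trans (m≤n*m t 16) 16t≤M))

      t≤d : t ≤ M ∸ t
      t≤d = +-cancelˡ-≤ t _ _ (≤-trans (≤-trans (≤-reflexive (cong (t +_) (sym (+-identityʳ t))))
              (*-monoˡ-≤ t {2} {16} (s≤s (s≤s z≤n)))) (≤-trans 16t≤M (≤-reflexive M≡)))

      E-split : ∀ a c → E a c M n f + E a c M n g ≡ ((a + c) ^ M) ^ n
      E-split a c = trans (sym (EL.add a c M n f g))
        (trans (EL.ext a c M n f+g) (E-mass a c M n))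

    -- The law of parameter 4 t / n has mean size at most 8 t and gives f probability at least 1 /
    -- (4 q) by `mass≤`. Taking disjunctions of j copies lowers the probability of g to 1 / (2 q),
    -- and the mean size stays at most 8 j t because the new parameter is at most 1/2.
    sparse-case : 8 * j * t ≤ n → m * Num n R ≤ q * Sum n R f
    sparse-case 8jt≤n =
      Levels.density≥ (gap c a j) (c ^ j) M n {{b′≢0}} {m = m} refl bd up f+g tail′ few
      where
      a = 4 * t
      8t≤n : 2 * a ≤ n
      8t≤n = ≤-trans (≤-trans (≤-reflexive (sym (*-assoc 2 4 t))) (*-monoˡ-≤ t (m≤m*n 8 j))) 8jt≤n
      a≤n : a ≤ n
      a≤n = ≤-trans (m≤n*m a 2) 8t≤n
      c = n ∸ a
      a+c : a + c ≡ n
      a+c = m+[n∸m]≡n a≤n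
      c+a : c + a ≡ n
      c+a = m∸n+n≡m a≤n
      n≤2c : n ≤ 2 * c
      n≤2c = +-cancelˡ-≤ n _ _ (begin
        n + n               ≡⟨ cong₂ _+_ (sym a+c) (sym a+c) ⟩
        (a + c) + (a + c)   ≡⟨ i a c ⟩
        2 * a + 2 * c       ≤⟨ +-monoˡ-≤ (2 * c) 8t≤n ⟩
        n + 2 * c ∎)
        where
        i : ∀ a c → (a + c) + (a + c) ≡ 2 * a + 2 * c
        i = solve-∀
      instance
        c≢0 : NonZero c
        c≢0 = >-nonZero (*-cancelˡ-< 2 0 c (≤-trans (≤-trans (s≤s z≤n) 2≤n) n≤2c))
        b≢0 : NonZero (a + c)
        b≢0 = subst NonZero (sym a+c) n≢0
        cj≢0 : NonZero (c ^ j)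
        cj≢0 = m^n≢0 c j
      b′≡ : gap c a j + c ^ j ≡ n ^ j
      b′≡ = trans (+-comm _ (c ^ j)) (trans (pow+gap c a j) (cong (_^ j) c+a))
      b′≢0 : NonZero (gap c a j + c ^ j)
      b′≢0 = subst NonZero (sym b′≡) (m^n≢0 n j)
      gap≤ : gap c a j ≤ c ^ j
      gap≤ = gap≤pow c a j {{subst NonZero (sym c+a) n≢0}} (begin
        2 * (j * (4 * t))  ≡⟨ i j t ⟩
        8 * j * t          ≤⟨ 8jt≤n ⟩
        n                  ≡⟨ c+a ⟨
        c + a ∎)
        where
        i : ∀ j t → 2 * (j * (4 * t)) ≡ 8 * j * t
        i = solve-∀
      likely : a + c * (2 * t) ≤ a * n
      likely = begin
        -- Here 2 ≤ n absorbs the lone summand: 4 t ≤ 2 n t.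
        4 * t + c * (2 * t)        ≤⟨ +-mono-≤ (*-monoˡ-≤ t (*-monoʳ-≤ 2 2≤n)) (*-monoˡ-≤ (2 * t) (m∸n≤m n a)) ⟩
        2 * n * t + n * (2 * t)    ≡⟨ i n t ⟩
        4 * t * n ∎
        where
        i : ∀ n t → 2 * n * t + n * (2 * t) ≡ 4 * t * n
        i = solve-∀
      tail : 2 * E a c M n total ≤ M * ((a + c) ^ M) ^ n
      tail = tail≤ a c M n 2 (begin
        2 * (n * (4 * t))          ≤⟨ *-monoʳ-≤ 2 (*-monoˡ-≤ (4 * t) n≤2c) ⟩
        2 * (2 * c * (4 * t))      ≡⟨ i c t ⟩
        16 * t * c                 ≤⟨ *-monoˡ-≤ c 16t≤M ⟩
        M * c ∎)
        where
        i : ∀ c t → 2 * (2 * c * (4 * t)) ≡ 16 * t * c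
        i = solve-∀
      tail′ : 2 * q * E (gap c a j) (c ^ j) M n total ≤ M * ((gap c a j + c ^ j) ^ M) ^ n
      tail′ = tail≤ (gap c a j) (c ^ j) M n (2 * q) (begin
        2 * q * (n * gap c a j)            ≡⟨ cong (λ x → 2 * q * (x * gap c a j)) c+a ⟨
        2 * q * ((c + a) * gap c a j)      ≤⟨ *-monoʳ-≤ (2 * q) (gap-upper c a j) ⟩
        2 * q * (j * a * (c + a) ^ j)      ≡⟨ cong (λ x → 2 * q * (j * a * x)) (pow+gap c a j) ⟨
        2 * q * (j * a * (c ^ j + gap c a j))
          ≤⟨ *-monoʳ-≤ (2 * q) (*-monoʳ-≤ (j * a) (+-monoʳ-≤ (c ^ j) gap≤)) ⟩
        2 * q * (j * a * (c ^ j + c ^ j))  ≡⟨ i q j t (c ^ j) ⟩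
        16 * q * j * t * c ^ j             ≤⟨ *-monoˡ-≤ (c ^ j) sparse≤M ⟩
        M * c ^ j ∎)
        where
        i : ∀ q j t p → 2 * q * (j * (4 * t) * (p + p)) ≡ 16 * q * j * t * p
        i = solve-∀
      Z = ((a + c) ^ M) ^ n
      Z≤ : Z ≤ 4 * q * E a c M n f
      Z≤ = Levels.mass≤ a c M n {q = q} up M≡ t≤d (s≤s z≤n) likely tail dense
      g-small : suc (3 + 4 * m) * E a c M n g ≤ (3 + 4 * m) * Z
      g-small = +-cancelˡ-≤ Z _ _ (begin
        Z + suc (3 + 4 * m) * E a c M n g
          ≤⟨ +-monoˡ-≤ _ (≤-trans Z≤ (≤-reflexive (cong (_* E a c M n f) 4q≡))) ⟩
        suc (3 + 4 * m) * E a c M n f + suc (3 + 4 * m) * E a c M n g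
          ≡⟨ *-distribˡ-+ (suc (3 + 4 * m)) (E a c M n f) _ ⟨
        suc (3 + 4 * m) * (E a c M n f + E a c M n g)
          ≡⟨ cong (suc (3 + 4 * m) *_) (E-split a c) ⟩
        Z + (3 + 4 * m) * Z ∎)
      few : 2 * q * E (gap c a j) (c ^ j) M n g ≤ ((gap c a j + c ^ j) ^ M) ^ n
      few = begin
        2 * q * E (gap c a j) (c ^ j) M n g
          ≡⟨ cong (_* E (gap c a j) (c ^ j) M n g) 2q≡ ⟩
        suc (1 + 2 * m) * E (gap c a j) (c ^ j) M n g
          ≤⟨ amplify (3 + 4 * m) (1 + 2 * m) {E a c M n g} {z = Z} g-small (max-power a c M n bd-g down-g j) ⟩
        Z ^ j
          ≡⟨ mass-power (a + c) M n j ⟨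
        (((a + c) ^ j) ^ M) ^ n
          ≡⟨ cong (λ x → (x ^ M) ^ n) (trans (cong (_^ j) a+c) (sym b′≡)) ⟩
        ((gap c a j + c ^ j) ^ M) ^ n ∎

    -- Here `mass≤` is applied to the minimum of k copies, giving f probability at least 1 / (4 q).
    -- If a single copy gave f at most 1 - 1 / (2 q), `min-power` would force at most 1 / (4 q + 1)
    -- for the minimum. So g is rare under a single copy, whose mean size is at most a constant
    -- times t.
    dense-case : n ≤ 8 * j * t → m * Num n R ≤ q * Sum n R f
    dense-case n≤8jt = Levels.density≥ a 1 M n {{a+1≢0}} {m = m} refl bd up f+g tail few
      where
      -- Rounding up gives t ≤ e n, also when t < n. The single copy has parameter 1 - 1 / B; the
      -- minimum of k copies then has 1 - s^k ≤ k / B = 1 / (8 e), so before truncation its mean per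
      -- coordinate is at least 8 e - 1.
      e = suc (t / n)
      B = 8 * k * e
      instance
        B≢0 : NonZero B
        B≢0 = _
      a = pred B
      B≡ : a + 1 ≡ B
      B≡ = trans (+-comm a 1) (suc-pred B)
      a+1≢0 : NonZero (a + 1)
      a+1≢0 = subst NonZero (sym B≡) B≢0
      k8≤B : 8 * k ≤ B
      k8≤B = m≤m*n (8 * k) e
      t≤en : t ≤ e * n
      t≤en = begin
        t                      ≡⟨ m≡m%n+[m/n]*n t n ⟩
        t % n + t / n * n      ≤⟨ +-monoˡ-≤ (t / n * n) (<⇒≤ (m%n<n t n)) ⟩
        n + t / n * n ∎
      en≤ : e * n ≤ (1 + 8 * j) * t
      en≤ = begin
        n + t / n * n          ≤⟨ +-mono-≤ n≤8jt (m/n*n≤m t n) ⟩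
        8 * j * t + t          ≡⟨ +-comm (8 * j * t) t ⟩
        (1 + 8 * j) * t ∎
      a′ = a ^ k
      c′ = gap a 1 k
      b′≡ : a′ + c′ ≡ B ^ k
      b′≡ = trans (pow+gap a 1 k) (cong (_^ k) B≡)
      instance
        a≢0 : NonZero a
        a≢0 = >-nonZero (≤-pred (≤-trans (≤-trans (s≤s (s≤s z≤n)) (≤-trans (m≤m*n 8 k) k8≤B))
                (≤-reflexive (sym (suc-pred B)))))
        b′≢0 : NonZero (a′ + c′)
        b′≢0 = subst NonZero (sym b′≡) (m^n≢0 B k)
      a′≤ac′ : a′ ≤ a * c′
      a′≤ac′ = ≤-trans (≤-reflexive (sym (*-identityˡ a′))) (gap-lower a 1 k)
      c′≢0 : NonZero c′
      c′≢0 = ≢-nonZero λ c′≡0 → <⇒≱ (m^n>0 a k)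
        (≤-trans a′≤ac′ (≤-reflexive (trans (cong (a *_) c′≡0) (*-zeroʳ a))))
      gap≤ : c′ ≤ a′
      gap≤ = gap≤pow a 1 k {{a+1≢0}} (begin
        2 * (k * 1)   ≡⟨ cong (2 *_) (*-identityʳ k) ⟩
        2 * k         ≤⟨ *-monoˡ-≤ k {2} {8} (s≤s (s≤s z≤n)) ⟩
        8 * k         ≤⟨ k8≤B ⟩
        B             ≡⟨ B≡ ⟨
        a + 1 ∎)
      likely : a′ + c′ * (2 * t) ≤ a′ * n
      -- Each summand takes half of the right-hand side: the first by 2 ≤ n, the second by c′ / a′ ≤
      -- 2 k / B and t ≤ e n.
      likely = *-cancelˡ-≤ (2 * B) {{m*n≢0 2 B}} (begin
        2 * B * (a′ + c′ * (2 * t))             ≡⟨ i₁ B a′ c′ t ⟩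
        2 * B * a′ + 4 * t * (B * c′)           ≤⟨ +-mono-≤ (*-monoˡ-≤ a′ (*-monoˡ-≤ B 2≤n)) (*-monoʳ-≤ (4 * t) Bc′≤) ⟩
        n * B * a′ + 4 * t * (2 * k * a′)       ≡⟨ i₂ n B a′ t k ⟩
        (n * B + 8 * k * t) * a′                ≤⟨ *-monoˡ-≤ a′ (+-monoʳ-≤ (n * B) (≤-trans (*-monoʳ-≤ (8 * k) t≤en)
                                                     (≤-reflexive (sym (*-assoc (8 * k) e n))))) ⟩
        (n * B + B * n) * a′                    ≡⟨ i₃ n B a′ ⟩
        2 * B * (a′ * n) ∎)
        where
        i₁ : ∀ B a c t → 2 * B * (a + c * (2 * t)) ≡ 2 * B * a + 4 * t * (B * c)
        i₁ = solve-∀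
        i₂ : ∀ n B a t k → n * B * a + 4 * t * (2 * k * a) ≡ (n * B + 8 * k * t) * a
        i₂ = solve-∀
        i₃ : ∀ n B a → (n * B + B * n) * a ≡ 2 * B * (a * n)
        i₃ = solve-∀
        i₄ : ∀ k a → k * 1 * (a + a) ≡ 2 * k * a
        i₄ = solve-∀
        Bc′≤ : B * c′ ≤ 2 * k * a′
        Bc′≤ = begin
          B * c′                      ≡⟨ cong (_* c′) B≡ ⟨
          (a + 1) * c′                ≤⟨ gap-upper a 1 k ⟩
          k * 1 * (a + 1) ^ k         ≡⟨ cong (k * 1 *_) (pow+gap a 1 k) ⟨
          k * 1 * (a′ + c′)           ≤⟨ *-monoʳ-≤ (k * 1) (+-monoʳ-≤ a′ gap≤) ⟩
          k * 1 * (a′ + a′)           ≡⟨ i₄ k a′ ⟩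
          2 * k * a′ ∎
      2qna≤M : 2 * q * (n * a) ≤ M
      2qna≤M = begin
        2 * q * (n * a)                       ≤⟨ *-monoʳ-≤ (2 * q) (*-monoʳ-≤ n (pred[n]≤n {B})) ⟩
        2 * q * (n * (8 * k * e))             ≡⟨ i₁ q n k e ⟩
        16 * q * k * (e * n)                  ≤⟨ *-monoʳ-≤ (16 * q * k) en≤ ⟩
        16 * q * k * ((1 + 8 * j) * t)        ≡⟨ *-assoc (16 * q * k) (1 + 8 * j) t ⟨
        16 * q * k * (1 + 8 * j) * t          ≤⟨ dense≤M ⟩
        M ∎
        where
        i₁ : ∀ q n k e → 2 * q * (n * (8 * k * e)) ≡ 16 * q * k * (e * n)
        i₁ = solve-∀
      tail : 2 * q * E a 1 M n total ≤ M * ((a + 1) ^ M) ^ n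
      tail = tail≤ a 1 M n (2 * q) (≤-trans 2qna≤M (≤-reflexive (sym (*-identityʳ M))))
      tail′ : 2 * E a′ c′ M n total ≤ M * ((a′ + c′) ^ M) ^ n
      tail′ = tail≤ a′ c′ M n 2 {{c′≢0}} (begin
        2 * (n * a′)                  ≤⟨ *-monoʳ-≤ 2 (*-monoʳ-≤ n a′≤ac′) ⟩
        2 * (n * (a * c′))            ≡⟨ i n a c′ ⟩
        2 * (n * a) * c′              ≤⟨ *-monoˡ-≤ c′ (*-monoˡ-≤ (n * a) (m≤m*n 2 q)) ⟩
        2 * q * (n * a) * c′          ≤⟨ *-monoˡ-≤ c′ 2qna≤M ⟩
        M * c′ ∎)
        where
        i : ∀ n a c → 2 * (n * (a * c)) ≡ 2 * (n * a) * c
        i = solve-∀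
      Z = ((a + 1) ^ M) ^ n
      Z′ = ((a′ + c′) ^ M) ^ n
      Z′≡ : Z′ ≡ Z ^ k
      Z′≡ = trans (cong (λ x → (x ^ M) ^ n) (pow+gap a 1 k)) (mass-power (a + 1) M n k)
      x = 1 + 2 * m
      Z′≤ : Z′ ≤ 4 * q * E a′ c′ M n f
      Z′≤ = Levels.mass≤ a′ c′ M n {q = q} up M≡ t≤d (s≤s z≤n) likely tail′ dense
      f-large : x * Z ≤ suc x * E a 1 M n f
      f-large with ≤-total (suc x * E a 1 M n f) (x * Z)
      ... | inj₂ large = large
      ... | inj₁ small = contradiction Z′>0 (≤⇒≯ Z′≤0)
        where
        Z′>0 : 0 < Z′
        Z′>0 = m^n>0 ((a′ + c′) ^ M) {{m^n≢0 (a′ + c′) M}} n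
        E≤0 : E a′ c′ M n f ≤ 0
        -- From (4 q + 1) E ≤ Z′ ≤ 4 q E it follows that E = 0, and then Z′ = 0, although Z′ is a
        -- positive mass.
        E≤0 = +-cancelʳ-≤ (4 * q * E a′ c′ M n f) _ _ (begin
          suc (4 * q) * E a′ c′ M n f  ≤⟨ amplify x (4 * q) {E a 1 M n f} {z = Z} small (min-power a 1 M n bd up k) ⟩
          Z ^ k                        ≡⟨ Z′≡ ⟨
          Z′                           ≤⟨ Z′≤ ⟩
          4 * q * E a′ c′ M n f ∎)
        Z′≤0 : Z′ ≤ 0
        Z′≤0 = ≤-trans Z′≤ (≤-trans (*-monoʳ-≤ (4 * q) E≤0) (≤-reflexive (*-zeroʳ (4 * q))))
      few : 2 * q * E a 1 M n g ≤ Z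
      few = +-cancelˡ-≤ (x * Z) _ _ (begin
        x * Z + 2 * q * E a 1 M n g              ≤⟨ +-mono-≤ f-large (≤-reflexive (cong (_* E a 1 M n g) 2q≡)) ⟩
        suc x * E a 1 M n f + suc x * E a 1 M n g  ≡⟨ *-distribˡ-+ (suc x) (E a 1 M n f) _ ⟨
        suc x * (E a 1 M n f + E a 1 M n g)      ≡⟨ cong (suc x *_) (E-split a 1) ⟩
        Z + x * Z                                ≡⟨ +-comm Z (x * Z) ⟩
        x * Z + Z ∎)

    density-amplification : m * Num n R ≤ q * Sum n R f
    density-amplification with ≤-total (8 * j * t) n
    ... | inj₁ p = sparse-case p
    ... | inj₂ p = dense-case p

-- Pebbling

bump-injective : ∀ {n} {x y : Vec ℕ (suc n)} → bump x ≡ bump y → x ≡ y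
bump-injective {x = _ ∷ _} {_ ∷ _} refl = refl

comps-unique : ∀ n r → Unique (comps n r)
comps-unique zero    zero    = [] ∷ []
comps-unique zero    (suc r) = []
comps-unique (suc n) zero    = Unique.map⁺ (λ { refl → refl }) (comps-unique n 0)
comps-unique (suc n) (suc r) = Unique.++⁺
  (Unique.map⁺ (λ { refl → refl }) (comps-unique n (suc r)))
  (Unique.map⁺ bump-injective (comps-unique (suc n) r))
  λ (p , q) → disjoint (∈-map⁻ (0 ∷_) p) (∈-map⁻ bump q)
  where
  disjoint : ∀ {x} → ∃[ y ] (y ∈ comps n (suc r) × x ≡ 0 ∷ y) →
             ∃[ y ] (y ∈ comps (suc n) r × x ≡ bump y) → _
  disjoint (_ , _ , refl) (_ ∷ _ , _ , ())

∈-comps⁺ : ∀ {n r} (x : Vec ℕ n) → total x ≡ r → x ∈ comps n r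
∈-comps⁺ {r = zero}  []          refl = here refl
∈-comps⁺ {r = zero}  (zero ∷ x)  e    = ∈-map⁺ (0 ∷_) (∈-comps⁺ x e)
∈-comps⁺ {r = suc r} (zero ∷ x)  e    = ∈-++⁺ˡ (∈-map⁺ (0 ∷_) (∈-comps⁺ x e))
∈-comps⁺ {r = suc r} (suc j ∷ x) e    =
  ∈-++⁺ʳ (map (0 ∷_) (comps _ (suc r))) (∈-map⁺ bump (∈-comps⁺ (j ∷ x) (suc-injective e)))

∈-comps⁻ : ∀ n r {x} → x ∈ comps n r → total x ≡ r
∈-comps⁻ zero    zero    (here refl) = refl
∈-comps⁻ (suc n) zero    p with ∈-map⁻ (0 ∷_) p
... | _ , q , refl = ∈-comps⁻ n 0 q
∈-comps⁻ (suc n) (suc r) p with ∈-++⁻ (map (0 ∷_) (comps n (suc r))) p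
... | inj₁ q with ∈-map⁻ (0 ∷_) q
...   | _ , q′ , refl = ∈-comps⁻ n (suc r) q′
∈-comps⁻ (suc n) (suc r) p | inj₂ q with ∈-map⁻ bump q
...   | _ ∷ _ , q′ , refl = cong suc (∈-comps⁻ (suc n) r q′)

-- Repetition-free lists with the same members are permutations of each other. Any counts supplied
-- from outside may thus be replaced by `Num` and `Sum`.
Count-unique : ∀ {A : Set} {P : A → Set} {k l} → Count P k → Count P l → k ≡ l
Count-unique (xs , ux , px , refl) (ys , uy , py , refl) = ↭-length (∼bag⇒↭
  (unique∧set⇒bag ux uy λ {x} → mk⇔ (from (py x) ∘ to (px x)) (from (px x) ∘ to (py x))))
  where open Equivalence

module _ {A : Set} {P : A → Set} (P? : Decidable P) where

  indicator : A → ℕ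
  indicator x = if does (P? x) then 1 else 0

  length-filter : ∀ xs → length (filter P? xs) ≡ sumˡ (map indicator xs)
  length-filter []       = refl
  length-filter (x ∷ xs) with does (P? x)
  ... | true  = cong suc (length-filter xs)
  ... | false = length-filter xs

  indicator≤1 : ∀ x → indicator x ≤ 1
  indicator≤1 x with does (P? x)
  ... | true  = ≤-refl
  ... | false = z≤n

  indicator-mono : ∀ {x y} → (P x → P y) → indicator x ≤ indicator y
  indicator-mono {x} {y} f with P? x | P? y
  ... | yes p | yes _ = ≤-refl
  ... | yes p | no ¬q = contradiction (f p) ¬q
  ... | no _  | _     = z≤n

NumDist-Num : ∀ n r → NumDist n r (Num n r)
NumDist-Num n r = comps n r , comps-unique n r , (λ x → mk⇔ (∈-comps⁻ n r) (∈-comps⁺ x)) , len (comps n r)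
  where
  len : ∀ {A : Set} (xs : List A) → length xs ≡ sumˡ (map (const 1) xs)
  len []       = refl
  len (_ ∷ xs) = cong suc (len xs)

total-suc : ∀ {n} (D : Vec ℕ n) v → total (D [ v ]%= suc) ≡ suc (total D)
total-suc (x ∷ D) zero    = refl
total-suc (x ∷ D) (suc v) = trans (cong (x +_) (total-suc D v)) (+-suc x (total D))

total-∸2 : ∀ {n} (D : Vec ℕ n) u → 2 ≤ lookup D u → 2 + total (D [ u ]%= (_∸ 2)) ≡ total D
total-∸2 (suc zero ∷ D)    zero    (s≤s ())
total-∸2 (suc (suc x) ∷ D) zero    _ = refl
total-∸2 (x ∷ D)           (suc u) h = begin
  2 + (x + total (D [ u ]%= (_∸ 2)))  ≡⟨ +-assoc 2 x _ ⟨
  2 + x + total (D [ u ]%= (_∸ 2))    ≡⟨ cong (_+ total (D [ u ]%= (_∸ 2))) (+-comm 2 x) ⟩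
  x + 2 + total (D [ u ]%= (_∸ 2))    ≡⟨ +-assoc x 2 _ ⟩
  x + (2 + total (D [ u ]%= (_∸ 2)))  ≡⟨ cong (x +_) (total-∸2 D u h) ⟩
  x + total D ∎
  where open ≡-Reasoning

lookup≤total : ∀ {n} (D : Vec ℕ n) i → lookup D i ≤ total D
lookup≤total (x ∷ D) zero    = m≤m+n x (total D)
lookup≤total (x ∷ D) (suc i) = ≤-trans (lookup≤total D i) (m≤n+m (total D) x)

updateAt-mono : ∀ {n} {f : ℕ → ℕ} → (∀ {a b} → a ≤ b → f a ≤ f b) →
                ∀ u {x y : Vec ℕ n} → x ⊑ y → (x [ u ]%= f) ⊑ (y [ u ]%= f)
updateAt-mono f↑ zero    {_ ∷ _} {_ ∷ _} p = ⊑-∷ (f↑ (p zero)) (p ∘ suc)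
updateAt-mono f↑ (suc u) {_ ∷ x} {_ ∷ y} p = ⊑-∷ (p zero) (updateAt-mono f↑ u {x} {y} (p ∘ suc))

move : ∀ {n} → Distribution n → Fin n → Fin n → Distribution n
move D u v = (D [ u ]%= (_∸ 2)) [ v ]%= suc

move-mono : ∀ {n} u v {x y : Distribution n} → x ⊑ y → move x u v ⊑ move y u v
move-mono u v {x} {y} p = updateAt-mono s≤s v {x [ u ]%= (_∸ 2)} {y [ u ]%= (_∸ 2)}
  (updateAt-mono (∸-monoˡ-≤ 2) u {x} {y} p)

total-move : ∀ {n} (D : Distribution n) u v → 2 ≤ lookup D u → suc (total (move D u v)) ≡ total D
total-move D u v h = trans (cong suc (total-suc (D [ u ]%= (_∸ 2)) v)) (total-∸2 D u h)

module _ {n} (G : SimpleGraph n) where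

  -- The same steps are replayed: each stays legal with more pebbles, and `move` preserves the
  -- order.
  Reachable-mono : ∀ {D D′ X} → D ⊑ D′ → Reachable G D X → ∃[ X′ ] (Reachable G D′ X′ × X ⊑ X′)
  Reachable-mono p ε = _ , ε , p
  Reachable-mono {D} {D′} p (step u v uv h ◅ rs) =
    let X′ , rs′ , q = Reachable-mono {D′ = move D′ u v} (move-mono u v {D} {D′} p) rs
    in X′ , step u v uv (≤-trans h (p u)) ◅ rs′ , q

  Solvable-mono : ∀ {D D′} → D ⊑ D′ → Solvable G D → Solvable G D′
  Solvable-mono {D} {D′} p s z =
    let X , r , h = s z
        X′ , r′ , q = Reachable-mono {D} {D′} p r
    in X′ , r′ , ≤-trans h (q z)

  -- Every step loses one pebble, so s bounds the depth of an exhaustive search and serves as its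
  -- recursion measure.
  solvableAt? : ∀ s D → total D ≤ s → ∀ z → Dec (SolvableAt G D z)
  solvableAt? s D D≤s z with 1 ≤? lookup D z
  ... | yes h = yes (D , ε , h)
  solvableAt? zero D D≤0 z | no ¬h = no λ where
    (_ , ε , h) → ¬h h
    (_ , step u v uv h ◅ _ , _) →
      contradiction (≤-trans h (≤-trans (lookup≤total D u) D≤0)) λ ()
  solvableAt? (suc s) D D≤s z | no ¬h =
    map′ (λ (u , v , uv , h , X , r , h′) → X , step u v uv h ◅ r , h′)
         (λ { (_ , ε , h) → contradiction h ¬h
            ; (X , step u v uv h ◅ r , h′) → u , v , uv , h , X , r , h′ })
         (any? λ u → any? λ v → (adj G u v ≟ᵇ true) ×-dec after u v)
    where
    after : ∀ u v → Dec (2 ≤ lookup D u × SolvableAt G (move D u v) z)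
    after u v with 2 ≤? lookup D u
    ... | no ¬h = no (¬h ∘ proj₁)
    ... | yes h = map′ (h ,_) proj₂ (solvableAt? s (move D u v)
                    (≤-pred (≤-trans (≤-reflexive (total-move D u v h)) D≤s)) z)

  solvable? : ∀ D → Dec (Solvable G D)
  solvable? D = all? (solvableAt? (total D) D ≤-refl)

  solvable : Distribution n → ℕ
  solvable = indicator solvable?

  NumSolvable-Sum : ∀ r → NumSolvable G r (Sum n r solvable)
  NumSolvable-Sum r = filter solvable? (comps n r)
    , Unique.filter⁺ solvable? (comps-unique n r)
    , (λ x → mk⇔ (λ p → let q , s = ∈-filter⁻ solvable? {xs = comps n r} p in ∈-comps⁻ n r q , s)
                 (λ (e , s) → ∈-filter⁺ solvable? (∈-comps⁺ x e) s))
    , length-filter solvable? (comps n r)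

  ¬solvable-empty : .{{NonZero n}} → ∀ {D} → total D ≡ 0 → ¬ Solvable G D
  ¬solvable-empty {D} e s = case s vertex of λ
    { (_ , ε , h)                → unoccupied vertex h
    ; (_ , step u _ _ h ◅ _ , _) → unoccupied u (≤-trans (s≤s z≤n) h) }
    where
    vertex : ∀ {k} .{{_ : NonZero k}} → Fin k
    vertex {suc _} = zero
    unoccupied : ∀ u → ¬ 1 ≤ lookup D u
    unoccupied u h = contradiction (≤-trans h (≤-trans (lookup≤total D u) (≤-reflexive e))) λ ()

  Sum-solvable-0 : .{{NonZero n}} → Sum n 0 solvable ≡ 0
  Sum-solvable-0 with Sum n 0 solvable | NumSolvable-Sum 0
  ... | zero  | _ = refl
  ... | suc _ | D ∷ _ , _ , p , _ =
    let e , s = Equivalence.to (p D) (here refl) in contradiction s (¬solvable-empty e)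

-- Rounding of rational scaling factors

module Rounding where

  open import Data.Bool using (T)
  open import Data.Integer as ℤ using (+_; ∣_∣)
  import Data.Integer.DivMod as ℤ
  import Data.Integer.Properties as ℤ
  import Data.Nat.Coprimality as Coprime
  open import Data.Rational as ℚ using (ℚ; mkℚ; 0ℚ; 1ℚ; ½; floor; ceiling; NonNegative; nonNegative; *≤*)
  import Data.Rational.Properties as ℚ
  open import Data.Unit using (tt)

  toℚ-mkℚ : ∀ a → toℚ a ≡ mkℚ (+ a) 0 (Coprime.sym (Coprime.1-coprimeTo a))
  toℚ-mkℚ a = ℚ.normalize-coprime (Coprime.sym (Coprime.1-coprimeTo a))

  toℚ-* : ∀ a b → toℚ (a * b) ≡ toℚ a ℚ.* toℚ b
  toℚ-* a b rewrite toℚ-mkℚ a | toℚ-mkℚ b = cong (ℚ._/ 1) (ℤ.pos-* a b)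

  toℚ-mono : ∀ {a b} → a ≤ b → toℚ a ℚ.≤ toℚ b
  toℚ-mono {a} {b} p rewrite toℚ-mkℚ a | toℚ-mkℚ b = *≤* (ℤ.*-monoʳ-≤-nonNeg (+ 1) (ℤ.+≤+ p))

  toℚ-cancel : ∀ {a b} → toℚ a ℚ.≤ toℚ b → a ≤ b
  toℚ-cancel {a} {b} p rewrite toℚ-mkℚ a | toℚ-mkℚ b =
    ℤ.drop‿+≤+ (ℤ.*-cancelʳ-≤-pos (+ a) (+ b) (+ 1) (ℚ.drop-*≤* p))

  ≤floor : ∀ a {q} → toℚ a ℚ.≤ q → + a ℤ.≤ floor q
  ≤floor a {q@(mkℚ i d-1 _)} p rewrite toℚ-mkℚ a = begin
    + a                                    ≤⟨ ℤ.i<j⇒i≤pred[j] {+ a} {ℤ.suc (i ℤ./ℕ suc d-1)} (ℤ.*-cancelʳ-<-nonNeg (+ suc d-1) a*d<) ⟩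
    ℤ.pred (ℤ.suc (i ℤ./ℕ suc d-1))        ≡⟨ ℤ.pred-suc (i ℤ./ℕ suc d-1) ⟩
    i ℤ./ℕ suc d-1                         ≡⟨ ℤ.div-pos-is-/ℕ i (suc d-1) ⟨
    i ℤ./ (+ suc d-1) ∎
    where
    open ℤ.≤-Reasoning
    a*d< : + a ℤ.* + suc d-1 ℤ.< ℤ.suc (i ℤ./ℕ suc d-1) ℤ.* + suc d-1
    a*d< = begin-strict
      + a ℤ.* + suc d-1     ≤⟨ ℚ.drop-*≤* p ⟩
      i ℤ.* + 1             ≡⟨ ℤ.*-identityʳ i ⟩
      i                     <⟨ ℤ.n<s[n/ℕd]*d i (suc d-1) ⟩
      ℤ.suc (i ℤ./ℕ suc d-1) ℤ.* + suc d-1 ∎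

  floor≤ : ∀ {q} → 0ℚ ℚ.≤ q → toℚ ∣ floor q ∣ ℚ.≤ q
  floor≤ {q@record{}} 0≤q rewrite toℚ-mkℚ ∣ floor q ∣ | ℤ.0≤i⇒+∣i∣≡i (≤floor 0 0≤q) =
    *≤* (ℤ.≤-trans (ℤ.[n/d]*d≤n (ℚ.↥ q) (ℚ.↧ q)) (ℤ.≤-reflexive (sym (ℤ.*-identityʳ (ℚ.↥ q)))))

  ≤roundℕ : ∀ a {q} → toℚ a ℚ.≤ q → a ≤ roundℕ q
  ≤roundℕ a {q} a≤q with q ℚ.≤ᵇ 0ℚ in eq
  -- `round` branches on the sign; in this branch q ≤ 0, which forces a = 0.
  ... | true = ≤-trans (toℚ-cancel {a} {0} (ℚ.≤-trans a≤q (ℚ.≤ᵇ⇒≤ (subst T (sym eq) tt)))) z≤n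
  ... | false = ℤ.drop‿+≤+ (ℤ.≤-trans a≤⌊⌋ (ℤ.≤-reflexive (sym (ℤ.0≤i⇒+∣i∣≡i (ℤ.≤-trans (ℤ.+≤+ z≤n) a≤⌊⌋)))))
    where
    a≤⌊⌋ : + a ℤ.≤ floor (q ℚ.+ ½)
    a≤⌊⌋ = ≤floor a (ℚ.≤-trans a≤q (subst (ℚ._≤ q ℚ.+ ½) (ℚ.+-identityʳ q) (ℚ.+-monoʳ-≤ q (*≤* (ℤ.+≤+ z≤n)))))

  ≤+½⇒≤double : ∀ {p q} → 1ℚ ℚ.≤ p → p ℚ.≤ q ℚ.+ ½ → p ℚ.≤ q ℚ.+ q
  ≤+½⇒≤double {p} {q} 1≤p p≤ = ℚ.≤-trans p≤ (ℚ.+-monoʳ-≤ q ½≤q)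
    where
    ½≤q : ½ ℚ.≤ q
    ½≤q = subst (½ ℚ.≤_) (trans (ℚ.+-assoc q ½ (ℚ.- ½)) (ℚ.+-identityʳ q))
            (ℚ.+-monoˡ-≤ (ℚ.- ½) (ℚ.≤-trans 1≤p p≤))

  toℚ≤double : ∀ r {q} → 0ℚ ℚ.≤ q → toℚ r ℚ.≤ q ℚ.+ ½ → toℚ r ℚ.≤ q ℚ.+ q
  toℚ≤double zero    0≤q _ = ℚ.+-mono-≤ 0≤q 0≤q
  toℚ≤double (suc r) {q} _ h = ≤+½⇒≤double {q = q} (toℚ-mono {1} {suc r} (s≤s z≤n)) h

  -- The rounded value is at most q + 1/2. If it is 0 the bound is clear; otherwise it is at least
  -- 1, so 1/2 ≤ q and rounding at most doubles.
  roundℕ≤ : ∀ {q} → 0ℚ ℚ.≤ q → toℚ (roundℕ q) ℚ.≤ q ℚ.+ q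
  roundℕ≤ {q} 0≤q = round≤ (q ℚ.≤ᵇ 0ℚ) refl
    where
    round≤ : ∀ b → (q ℚ.≤ᵇ 0ℚ) ≡ b →
             toℚ ∣ if b then ceiling (q ℚ.- ½) else floor (q ℚ.+ ½) ∣ ℚ.≤ q ℚ.+ q
    round≤ true  eq = subst (λ p → toℚ ∣ ceiling (p ℚ.- ½) ∣ ℚ.≤ p ℚ.+ p)
                        (ℚ.≤-antisym 0≤q (ℚ.≤ᵇ⇒≤ (subst T (sym eq) tt))) ℚ.≤-refl
    round≤ false _  = toℚ≤double ∣ floor (q ℚ.+ ½) ∣ 0≤q
                        (floor≤ (ℚ.+-mono-≤ {0ℚ} {q} {0ℚ} {½} 0≤q (*≤* (ℤ.+≤+ z≤n))))

  times-≥ : ∀ t ω K n → toℚ K ℚ.≤ ω n → K * t n ≤ times t ω n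
  times-≥ t ω K n K≤ω = ≤roundℕ (K * t n) (begin
    toℚ (K * t n)       ≡⟨ cong toℚ (*-comm K (t n)) ⟩
    toℚ (t n * K)       ≡⟨ toℚ-* (t n) K ⟩
    toℚ (t n) ℚ.* toℚ K   ≤⟨ ℚ.*-monoˡ-≤-nonNeg (toℚ (t n)) {{nonNegative (toℚ-mono {0} {t n} z≤n)}} K≤ω ⟩
    toℚ (t n) ℚ.* ω n ∎)
    where open ℚ.≤-Reasoning

  -- The factor 2 is the price of rounding, from `roundℕ≤`.
  divide-≤ : ∀ t ω pos K n → toℚ K ℚ.≤ ω n → divide t ω pos n * K ≤ 2 * t n
  divide-≤ t ω pos K n K≤ω = toℚ-cancel (begin
    toℚ (r * K)                       ≡⟨ toℚ-* r K ⟩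
    toℚ r ℚ.* toℚ K                     ≤⟨ ℚ.*-monoˡ-≤-nonNeg (toℚ r) {{nonNegative (toℚ-mono {0} {r} z≤n)}} K≤ω ⟩
    toℚ r ℚ.* ω n                       ≤⟨ ℚ.*-monoʳ-≤-nonNeg (ω n) (roundℕ≤ 0≤x) ⟩
    (x ℚ.+ x) ℚ.* ω n                   ≡⟨ ℚ.*-distribʳ-+ (ω n) x x ⟩
    x ℚ.* ω n ℚ.+ x ℚ.* ω n             ≡⟨ cong₂ ℚ._+_ xω xω ⟩
    toℚ (t n) ℚ.+ toℚ (t n)             ≡⟨ cong₂ ℚ._+_ (ℚ.*-identityˡ (toℚ (t n))) (ℚ.*-identityˡ (toℚ (t n))) ⟨
    1ℚ ℚ.* toℚ (t n) ℚ.+ 1ℚ ℚ.* toℚ (t n)  ≡⟨ ℚ.*-distribʳ-+ (toℚ (t n)) 1ℚ 1ℚ ⟨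
    toℚ 2 ℚ.* toℚ (t n)                 ≡⟨ toℚ-* 2 (t n) ⟨
    toℚ (2 * t n) ∎)
    where
    open ℚ.≤-Reasoning
    r = divide t ω pos n
    instance
      ω>0 : Positive (ω n)
      ω>0 = pos n
      ω≥0 : NonNegative (ω n)
      ω≥0 = ℚ.pos⇒nonNeg (ω n)
      ω≢0 : ℚ.NonZero (ω n)
      ω≢0 = ℚ.pos⇒nonZero (ω n)
    x = toℚ (t n) ℚ.÷ ω n
    xω : x ℚ.* ω n ≡ toℚ (t n)
    xω = trans (ℚ.*-assoc (toℚ (t n)) (ℚ.1/ ω n) (ω n))
           (trans (cong (toℚ (t n) ℚ.*_) (ℚ.*-inverseˡ (ω n))) (ℚ.*-identityʳ (toℚ (t n))))
    0≤x : 0ℚ ℚ.≤ x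
    0≤x = ℚ.*-cancelʳ-≤-pos (ω n) (subst₂ ℚ._≤_ (sym (ℚ.*-zeroˡ (ω n))) (sym xω) (toℚ-mono {0} {t n} z≤n))

-- From amplification to the threshold

open Rounding using (times-≥; divide-≤)
open Amplification using (density-amplification)

solvable-increasing : ∀ {n} (G : SimpleGraph n) → Increasing (solvable G)
solvable-increasing G {x} {y} p = indicator-mono (solvable? G) (Solvable-mono G {x} {y} p)

solvable≤Num : ∀ {n} (G : SimpleGraph n) r → Sum n r (solvable G) ≤ Num n r
solvable≤Num {n} G r = Sum-mono n r (indicator≤1 (solvable? G))

half⇒dense : ∀ {n} (G : SimpleGraph n) {r} → ProbAtLeastHalf G r → Num n r ≤ 2 * Sum n r (solvable G)
half⇒dense {n} G {r} (_ , _ , ck , cN , h) = subst₂ (λ N k → N ≤ 2 * k)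
  (Count-unique cN (NumDist-Num n r)) (Count-unique ck (NumSolvable-Sum G r)) h

dense⇒half : ∀ {n} (G : SimpleGraph n) {r} → Num n r ≤ 2 * Sum n r (solvable G) → ProbAtLeastHalf G r
dense⇒half {n} G {r} h = _ , _ , NumSolvable-Sum G r , NumDist-Num n r , h

-- Without pebbles no vertex can be reached, so at size 0 the probability is 0. Amplification needs
-- a positive starting size.
half⇒pos : ∀ {n} (G : SimpleGraph n) .{{_ : NonZero n}} {r} → ProbAtLeastHalf G r → 1 ≤ r
half⇒pos G {suc r} _ = s≤s z≤n
half⇒pos {n} G {zero} h = contradiction (half⇒dense G h)
  (<⇒≱ (subst (_< Num n 0) (cong (2 *_) (sym (Sum-solvable-0 G))) (Num-pos n 0)))

-- Abstract because normalising the constant is infeasible.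
abstract
  graph-amplification : ∀ m → ∃[ K ] ∀ {n t R} (G : SimpleGraph n) → 2 ≤ n → 1 ≤ t → K * t ≤ R →
    Num n t ≤ suc m * Sum n t (solvable G) → m * Num n R ≤ suc m * Sum n R (solvable G)
  graph-amplification m = Amplification.K m , λ G 2≤n 1≤t Kt≤R → density-amplification m 2≤n 1≤t Kt≤R
    (indicator≤1 (solvable? G)) (λ {x} {y} → solvable-increasing G {x} {y})

theorem3 : (G : (n : ℕ) → SimpleGraph n) → (∀ n → Connected (G n)) →
    (t : ℕ → ℕ) → (∀ n → 1 ≤ n → IsMinHalf (G n) (t n)) →
    IsThreshold G t
theorem3 G _ t half ω pos ω→∞ = almostAll , almostNone
  where
  open ≤-Reasoning

  module _ (m : ℕ) where
    -- Amplification with q = m + 2 serves both limits: densities 1/2 and 1 / (m + 1) are each at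
    -- least 1 / q, and the resulting 1 - 1 / q is at least both m / (m + 1) and 1/2.
    K = proj₁ (graph-amplification (suc m))
    amplification = proj₂ (graph-amplification (suc m))

    module _ {n : ℕ} (2≤n : 2 ≤ n) where
      1≤n : 1 ≤ n
      1≤n = ≤-trans (s≤s z≤n) 2≤n
      instance
        n≢0 : NonZero n
        n≢0 = >-nonZero 1≤n
      H : Distribution n → ℕ
      H = solvable (G n)
      1≤t : 1 ≤ t n
      1≤t = half⇒pos (G n) (proj₁ (half n 1≤n))

      above : toℚ K ≤ℚ ω n →
              m * Num n (times t ω n) ≤ suc m * Sum n (times t ω n) H
      above K≤ω = +-cancelʳ-≤ (Num n R) _ _ (begin
        m * Num n R + Num n R          ≡⟨ +-comm (m * Num n R) (Num n R) ⟩
        suc m * Num n R                ≤⟨ amplification (G n) 2≤n 1≤t (times-≥ t ω K n K≤ω) dense ⟩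
        suc (suc m) * Sum n R H        ≡⟨ +-comm (Sum n R H) (suc m * Sum n R H) ⟩
        suc m * Sum n R H + Sum n R H  ≤⟨ +-monoʳ-≤ (suc m * Sum n R H) (solvable≤Num (G n) R) ⟩
        suc m * Sum n R H + Num n R ∎)
        where
        R = times t ω n
        dense : Num n (t n) ≤ suc (suc m) * Sum n (t n) H
        dense = ≤-trans (half⇒dense (G n) (proj₁ (half n 1≤n)))
                  (*-monoˡ-≤ (Sum n (t n) H) (s≤s (s≤s {0} {m} z≤n)))

      -- A density above 1 / (m + 1) at size r would be amplified to at least 1/2 at size t - 1,
      -- against the minimality of t.
      below : toℚ (2 * suc K) ≤ℚ ω n → ∀ r → r * (2 * suc K) ≤ 2 * t n →
              suc m * Sum n r H ≤ Num n r
      -- The quotient may round to 0, where amplification cannot start; the density there is 0.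
      below K≤ω zero    _ = ≤-trans (≤-reflexive (trans (cong (suc m *_) (Sum-solvable-0 (G n))) (*-zeroʳ (suc m)))) z≤n
      below K≤ω (suc r) h with suc m * Sum n (suc r) H ≤? Num n (suc r)
      ... | yes p = p
      ... | no ¬p = contradiction (dense⇒half (G n) sparse) (proj₂ (half n 1≤n) R (≤-reflexive (suc-pred (t n))))
        where
        instance
          t≢0 : NonZero (t n)
          t≢0 = >-nonZero 1≤t
        R = pred (t n)
        i : ∀ k r → 2 * (1 + k * (1 + r)) + 2 * r ≡ (1 + r) * (2 * (1 + k))
        i = solve-∀
        -- The 2 in 2 (K + 1) cancels the rounding factor. The extra 1 leaves room to stop at t - 1,
        -- since the size `suc r` is at least 1.
        KR : K * suc r ≤ R
        KR = ≤-pred (≤-trans (*-cancelˡ-≤ 2 (≤-trans (m≤m+n _ (2 * r)) (≤-trans (≤-reflexive (i K r)) h)))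
               (≤-reflexive (sym (suc-pred (t n)))))
        dense : Num n (suc r) ≤ suc (suc m) * Sum n (suc r) H
        dense = ≤-trans (<⇒≤ (≰⇒> ¬p)) (m≤n+m (suc m * Sum n (suc r) H) (Sum n (suc r) H))
        j : ∀ m x → 2 * (1 + m) * x ≡ (1 + m) * (2 * x)
        j = solve-∀
        sparse : Num n R ≤ 2 * Sum n R H
        sparse = *-cancelˡ-≤ (suc m) (begin
          suc m * Num n R              ≤⟨ amplification (G n) 2≤n (s≤s z≤n) KR dense ⟩
          suc (suc m) * Sum n R H      ≤⟨ *-monoˡ-≤ (Sum n R H) (≤-trans (m≤m+n (2 + m) m) (≤-reflexive (k m))) ⟩
          2 * suc m * Sum n R H        ≡⟨ j m (Sum n R H) ⟩
          suc m * (2 * Sum n R H) ∎)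
          where
          k : ∀ m → 2 + m + m ≡ 2 * (1 + m)
          k = solve-∀

  almostAll : ProbTendsTo1 G (times t ω)
  almostAll m =
    let n₁ , large = ω→∞ (toℚ (K m))
    -- Amplification is stated for n ≥ 2; the limit allows smaller n to be skipped.
    in 2 ⊔ n₁ , λ n n₀≤n k N ck cN → subst₂ (λ N k → m * N ≤ suc m * k)
         (Count-unique (NumDist-Num n (times t ω n)) cN) (Count-unique (NumSolvable-Sum (G n) (times t ω n)) ck)
         (above m (m⊔n≤o⇒m≤o 2 n₁ n₀≤n) (large n (m⊔n≤o⇒n≤o 2 n₁ n₀≤n)))

  almostNone : ProbTendsTo0 G (divide t ω pos)
  almostNone m =
    let n₁ , large = ω→∞ (toℚ (2 * suc (K m)))
        r = divide t ω pos
    in 2 ⊔ n₁ , λ n n₀≤n k N ck cN →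
         let K≤ω = large n (m⊔n≤o⇒n≤o 2 n₁ n₀≤n) in subst₂ (λ N k → suc m * k ≤ N)
         (Count-unique (NumDist-Num n (r n)) cN) (Count-unique (NumSolvable-Sum (G n) (r n)) ck)
         (below m (m⊔n≤o⇒m≤o 2 n₁ n₀≤n) K≤ω (r n) (divide-≤ t ω pos (2 * suc (K m)) n K≤ω))
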